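{- Let $\overline{N}(m,n)$ denote the number of overpartitions of $n$ with $D$-rank $m$, and let $\overline{N2}(m,n)$ denote the number of overpartitions of $n$ with $M_2$-rank $m$. Then for all integers $m,n\geq 0$, $$\overline{N}(m,n)\geq \overline{N}(m+2,n)\quad\text{and}\quad \overline{N2}(m,n)\geq \overline{N2}(m+2,n).$$
   Context: An overpartition of a nonnegative integer $n$ is a partition of $n$ (a weakly decreasing finite sequence of positive integers summing to $n$) in which the first occurrence of each distinct part value may (or may not) be overlined. For an overpartition $\lambda$, let $\lambda_1$ be its largest part (taken to be $0$ for the empty overpartition) and $\ell(\lambda)$ its number of parts. The $D$-rank of $\lambda$ is $\lambda_1-\ell(\lambda)$. Let $\lambda_o$ denote the partition consisting of the non-overlined odd parts of $\lambda$, and let $\chi(\lambda)=1$ if the largest part of $\lambda$ is odd and non-overlined, and $\chi(\lambda)=0$ otherwise. The $M_2$-rank of $\lambda$ is $\lfloor \lambda_1/2\rfloor-\ell(\lambda)+\ell(\lambda_o)-\chi(\lambda)$. Equivalently, with $(a;q)_k=\prod_{i=0}^{k-1}(1-aq^i)$, $$\sum_{n\ge0}\sum_{m\in\mathbb{Z}}\overline{N}(m,n)z^mq^n=\sum_{k\ge0}\frac{(-1;q)_k q^{k(k+1)/2}}{(zq;q)_k(q/z;q)_k},\qquad \sum_{n\ge0}\sum_{m\in\mathbb{Z}}\overline{N2}(m,n)z^mq^n=\sum_{k\ge0}\frac{(-1;q)_{2k} q^{k}}{(zq^2;q^2)_k(q^2/z;q^2)_k}.$$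
   Formalization: The M₂-rank is taken with ⌈λ₁/2⌉ instead of ⌊λ₁/2⌋: the floor formula contradicts the stated generating function (at n=1 it gives both overpartitions rank −1, while the generating function gives rank 0). -}

module Defs where

import Data.Nat
open import Data.Nat using (ℕ; zero; suc; _+_; _≤ᵇ_; _≡ᵇ_; ⌈_/2⌉)
open import Data.Bool using (Bool; true; false; _∧_; _∨_; not)
open import Data.List using (List; []; _∷_; map; concatMap; applyUpTo; length; filterᵇ)
open import Data.Nat.ListAction using (sum)
open import Data.Product using (_×_; _,_; proj₁)
open import Data.Integer as ℤ using (ℤ; +_; _-_)
open import Relation.Nullary.Decidable using (⌊_⌋)

-- A candidate overpartition: list of parts in order, each part paired with
-- its overline flag (true = overlined).
Cand : Set
Cand = List (ℕ × Bool)

-- Validity: all parts positive, weakly decreasing, and a part may be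
-- overlined only if it is the first occurrence of its value (i.e. it is not
-- equal to the preceding part).
valid : Cand → Bool
valid [] = true
valid ((p , b) ∷ []) = 1 ≤ᵇ p
valid ((p , b) ∷ (q , c) ∷ rest) =
  (1 ≤ᵇ p) ∧ (q ≤ᵇ p) ∧ (not (p ≡ᵇ q) ∨ not c) ∧ valid ((q , c) ∷ rest)

size : Cand → ℕ
size l = sum (map proj₁ l)

words : {A : Set} → List A → ℕ → List (List A)
words xs zero = [] ∷ []
words xs (suc L) = [] ∷ concatMap (λ x → map (x ∷_) (words xs L)) xs

letters : ℕ → List (ℕ × Bool)
letters n = concatMap (λ p → (p , false) ∷ (p , true) ∷ []) (applyUpTo suc n)

overpartitions : ℕ → List Cand
overpartitions n = filterᵇ (λ l → valid l ∧ (size l ≡ᵇ n)) (words (letters n) n)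

largest : Cand → ℕ
largest [] = 0
largest ((p , _) ∷ _) = p

numNonOverOdd : Cand → ℕ
numNonOverOdd [] = 0
numNonOverOdd ((p , b) ∷ l) with not b ∧ not (p Data.Nat.% 2 ≡ᵇ 0)
... | true  = suc (numNonOverOdd l)
... | false = numNonOverOdd l

chi : Cand → ℕ
chi [] = 0
chi ((p , b) ∷ _) with not b ∧ not (p Data.Nat.% 2 ≡ᵇ 0)
... | true  = 1
... | false = 0

dRank : Cand → ℤ
dRank l = (+ largest l) - (+ length l)

m2Rank : Cand → ℤ
m2Rank l = (((+ ⌈ largest l /2⌉) - (+ length l)) ℤ.+ (+ numNonOverOdd l)) - (+ chi l)

Nbar : ℤ → ℕ → ℕ
Nbar m n = length (filterᵇ (λ l → ⌊ dRank l ℤ.≟ m ⌋) (overpartitions n))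

Nbar2 : ℤ → ℕ → ℕ
Nbar2 m n = length (filterᵇ (λ l → ⌊ m2Rank l ℤ.≟ m ⌋) (overpartitions n))

{-# OPTIONS --safe #-}
module Submission where

-- Write t = z⁻¹.  Both rank generating functions have the form
--   T₀ = Σ_k e_k / ((tp;p)_k (zp;p)_k)
-- with p = q (D-rank) or p = q² (M₂-rank) and e_k a power series in q with
-- nonnegative coefficients.  Since 1 / ((1 - tx)(1 - zx)) = Σ_j x^j χ_j with
-- χ_j = z^j + z^(j-2) + ... + z^(-j), multiplying by such a factor preserves
-- the property "the coefficient of z^m equals that of z^(-m) and is at least
-- that of z^(m+2) for m ≥ 0" (Clebsch-Gordan).  Hence T₀ has it term by term.
--
-- That T₀ enumerates overpartitions by rank is a case of a ₃φ₂ transformation.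
-- Replacing (tp;p)_k by (tp^(j+1);p)_k and e_k by p^(jk) e_k gives series T_j
-- that satisfy a first order recurrence in j, proved by telescoping over k.
-- Iterating it peels off the possible parts in increasing size.
--
-- Everything is done modulo a power of q and without subtraction, in a
-- commutative semiring where q is nilpotent, so that 1 / (1 - x) is a finite
-- geometric sum.

open import Defs
open import Algebra.Bundles using (CommutativeSemiring)
import Algebra.Properties.CommutativeSemigroup
import Algebra.Properties.CommutativeSemiring.Exp
import Algebra.Properties.Semiring.Exp
import Algebra.Solver.Ring.NaturalCoefficients.Default
import Algebra.Structures.Biased
open import Data.Bool as Bool using (Bool; true; false; not; _∧_; _∨_; if_then_else_)
open import Data.Empty using (⊥-elim)
open import Data.Integer as ℤ using (ℤ; +_; -[1+_])
import Data.Integer.Properties as ℤ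
import Data.Integer.Solver
open import Data.List using (List; []; _∷_; _++_; map; concatMap; applyUpTo; length; filterᵇ)
open import Data.Nat as ℕ using (ℕ; zero; suc; s≤s; z≤n; _≤ᵇ_; _≡ᵇ_; ⌈_/2⌉; ⌊_/2⌋)
import Data.Nat.Properties as ℕ
open import Data.Product using (_×_; _,_; ∃; proj₁)
open import Data.Sum using (inj₁; inj₂)
open import Data.Unit using (tt)
open import Function.Bundles using (mk⇔)
open import Level using (0ℓ)
open import Relation.Binary.PropositionalEquality as ≡ using (_≡_)
import Relation.Binary.Reasoning.Setoid
open import Relation.Binary.Structures using (IsEquivalence)
open import Relation.Nullary.Decidable using (⌊_⌋; does-⇔; isYes≗does)

module ℕ-+ = Algebra.Properties.CommutativeSemigroup ℕ.+-commutativeSemigroup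

-- q-series modulo a power of q

-- Stands for N[z, 1/z][q] modulo q^(order+1), with `t` for 1/z. Cancellation replaces subtraction:
-- an identity with negative terms is proved after the same terms have been added to both sides.
record LaurentTruncation : Set₁ where
  field
    commutativeSemiring : CommutativeSemiring 0ℓ 0ℓ
  open CommutativeSemiring commutativeSemiring public
  open Algebra.Properties.Semiring.Exp semiring public
  open Algebra.Properties.CommutativeSemiring.Exp commutativeSemiring public
    using (^-distrib-*)
  field
    +-cancelʳ : ∀ c {a b} → a + c ≈ b + c → a ≈ b
    z t q : Carrier
    z*t≈1 : z * t ≈ 1#
    order : ℕ
    q^[1+order]≈0 : q ^ suc order ≈ 0#

module Truncated (S : LaurentTruncation) where
  open LaurentTruncation S public
  module Solver = Algebra.Solver.Ring.NaturalCoefficients.Default commutativeSemiring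
  open Solver using (solve; _:+_; _:*_; _:=_; con) public
  open Relation.Binary.Reasoning.Setoid setoid

  q^n≈0 : ∀ {n} → order ℕ.< n → q ^ n ≈ 0#
  q^n≈0 {n} order<n = begin
    q ^ n                                      ≡⟨ ≡.cong (q ^_) (ℕ.m+[n∸m]≡n order<n) ⟨
    q ^ (suc order ℕ.+ (n ℕ.∸ suc order))      ≈⟨ ^-homo-* q (suc order) _ ⟩
    q ^ suc order * q ^ (n ℕ.∸ suc order)      ≈⟨ *-congʳ q^[1+order]≈0 ⟩
    0# * q ^ (n ℕ.∸ suc order)                 ≈⟨ zeroˡ _ ⟩
    0#                                         ∎

  q^n*x≈0 : ∀ {n} x → order ℕ.< n → q ^ n * x ≈ 0#
  q^n*x≈0 x order<n = trans (*-congʳ (q^n≈0 order<n)) (zeroˡ x)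

  ∑ : ℕ → (ℕ → Carrier) → Carrier
  ∑ zero    f = 0#
  ∑ (suc n) f = ∑ n f + f n

  ∑-cong< : ∀ n {f g} → (∀ i → i ℕ.< n → f i ≈ g i) → ∑ n f ≈ ∑ n g
  ∑-cong< zero    f≈g = refl
  ∑-cong< (suc n) f≈g =
    +-cong (∑-cong< n (λ i i<n → f≈g i (ℕ.m<n⇒m<1+n i<n))) (f≈g n ℕ.≤-refl)

  ∑-cong : ∀ n {f g} → (∀ i → f i ≈ g i) → ∑ n f ≈ ∑ n g
  ∑-cong n f≈g = ∑-cong< n (λ i _ → f≈g i)

  ∑-zero : ∀ n {f} → (∀ i → f i ≈ 0#) → ∑ n f ≈ 0#
  ∑-zero zero    f≈0 = refl
  ∑-zero (suc n) f≈0 = trans (+-cong (∑-zero n f≈0) (f≈0 n)) (+-identityʳ 0#)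

  ∑-distribˡ : ∀ c n f → ∑ n (λ i → c * f i) ≈ c * ∑ n f
  ∑-distribˡ c zero    f = sym (zeroʳ c)
  ∑-distribˡ c (suc n) f =
    trans (+-congʳ (∑-distribˡ c n f)) (sym (distribˡ c _ _))

  ∑-+ : ∀ n f g → ∑ n (λ i → f i + g i) ≈ ∑ n f + ∑ n g
  ∑-+ zero    f g = sym (+-identityˡ 0#)
  ∑-+ (suc n) f g = trans (+-congʳ (∑-+ n f g))
    (solve 4 (λ a b c d → (a :+ b) :+ (c :+ d) := (a :+ c) :+ (b :+ d)) refl _ _ _ _)

  ∑-suc : ∀ n f → ∑ (suc n) f ≈ f 0 + ∑ n (λ i → f (suc i))
  ∑-suc zero    f = +-comm 0# (f 0)
  ∑-suc (suc n) f = trans (+-congʳ (∑-suc n f)) (+-assoc _ _ _)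

  ∑-truncate : ∀ {m n} f → m ℕ.≤ n → (∀ i → m ℕ.≤ i → f i ≈ 0#) → ∑ n f ≈ ∑ m f
  ∑-truncate {m} {n} f m≤n f≈0 = go n m≤n
    where
    go : ∀ k → m ℕ.≤ k → ∑ k f ≈ ∑ m f
    go k m≤k with ℕ.m≤n⇒m<n∨m≡n m≤k
    ... | inj₂ ≡.refl = refl
    ... | inj₁ (s≤s {n = k′} m≤k′) =
      trans (+-cong (go k′ m≤k′) (f≈0 k′ m≤k′)) (+-identityʳ _)

  -- Geometric series in nilpotent elements.

  inv : Carrier → Carrier
  inv x = ∑ (suc order) (x ^_)

  inv-cong : ∀ {x y} → x ≈ y → inv x ≈ inv y
  inv-cong x≈y = ∑-cong (suc order) (λ i → ^-congˡ i x≈y)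

  -- Multiples of `q` are nilpotent, which makes `inv x` a genuine inverse of 1 - x. The cofactor is
  -- kept as data so that powers of `q` can be pulled out of products.
  record Small (x : Carrier) : Set where
    constructor small
    field
      quotient : Carrier
      factors  : x ≈ q * quotient

  *-small : ∀ {x} y → Small x → Small (y * x)
  *-small y (small x′ x≈qx′) = small (y * x′) (trans (*-congˡ x≈qx′)
    (solve 3 (λ y q x → y :* (q :* x) := q :* (y :* x)) refl y q x′))

  small-* : ∀ {x} y → Small x → Small (x * y)
  small-* y (small x′ x≈qx′) = small (x′ * y) (trans (*-congʳ x≈qx′) (*-assoc _ _ _))

  ^-small : ∀ {x} n → Small x → Small (x ^ suc n)
  ^-small n = small-* _

  q-small : Small q
  q-small = small 1# (sym (*-identityʳ q))

  small^N≈0 : ∀ {x} → Small x → x ^ suc order ≈ 0#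
  small^N≈0 {x} (small y x≈qy) = begin
    x ^ suc order                 ≈⟨ ^-congˡ (suc order) x≈qy ⟩
    (q * y) ^ suc order           ≈⟨ ^-distrib-* q y (suc order) ⟩
    q ^ suc order * y ^ suc order ≈⟨ q^n*x≈0 _ ℕ.≤-refl ⟩
    0#                            ∎

  geometric-sum : ∀ x n → 1# + x * ∑ n (x ^_) ≈ ∑ n (x ^_) + x ^ n
  geometric-sum x zero    = trans (+-congˡ (zeroʳ x)) (+-comm 1# 0#)
  geometric-sum x (suc n) = begin
    1# + x * (∑ n (x ^_) + x ^ n)
      ≈⟨ solve 4 (λ o x s y → o :+ x :* (s :+ y) := (o :+ x :* s) :+ x :* y) refl _ _ _ _ ⟩
    (1# + x * ∑ n (x ^_)) + x * x ^ n
      ≈⟨ +-congʳ (geometric-sum x n) ⟩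
    (∑ n (x ^_) + x ^ n) + x ^ suc n  ∎

  inv-unfold : ∀ {x} → Small x → inv x ≈ 1# + x * inv x
  inv-unfold {x} x-small = sym (begin
    1# + x * inv x           ≈⟨ geometric-sum x (suc order) ⟩
    inv x + x ^ suc order    ≈⟨ +-congˡ (small^N≈0 x-small) ⟩
    inv x + 0#               ≈⟨ +-identityʳ _ ⟩
    inv x                    ∎)

  -- (1 - t²) / ((1 - tx)(1 - zx)) = 1 / (1 - zx) - t² / (1 - tx), with the
  -- negative terms moved to the other side.
  inv-pair : ∀ {x} → Small x →
    inv (t * x) * inv (z * x) + t * (t * inv (t * x)) ≈
    inv (z * x) + t * (t * (inv (t * x) * inv (z * x)))
  inv-pair {x} x-small = begin
    a * b + t * (t * a)
      ≈⟨ +-congʳ (*-congʳ (inv-unfold (*-small t x-small))) ⟩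
    (1# + t * x * a) * b + t * (t * a)
      ≈⟨ solve 4 (λ t x a b → (con 1 :+ t :* x :* a) :* b :+ t :* (t :* a) :=
           b :+ t :* (t :* a :+ con 1 :* (x :* (a :* b)))) refl t x a b ⟩
    b + t * (t * a + 1# * (x * (a * b)))
      ≈⟨ +-congˡ (*-congˡ (+-congˡ (*-congʳ z*t≈1))) ⟨
    b + t * (t * a + z * t * (x * (a * b)))
      ≈⟨ solve 5 (λ z t x a b → b :+ t :* (t :* a :+ z :* t :* (x :* (a :* b))) :=
           b :+ t :* (t :* (a :* (con 1 :+ z :* x :* b)))) refl z t x a b ⟩
    b + t * (t * (a * (1# + z * x * b)))
      ≈⟨ +-congˡ (*-congˡ (*-congˡ (*-congˡ (inv-unfold (*-small z x-small))))) ⟨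
    b + t * (t * (a * b)) ∎
    where
    a = inv (t * x)
    b = inv (z * x)

  -- The series `T j` and their recurrence in `j`.

  record Parameters : Set where
    field
      p-quotient : Carrier
      -- `s` determines the numerators. Read on partitions, `y j` is the weight of a non-overlined
      -- odd part (0 for the D-rank), and `X j` is the product of 1 + weight over the overlined
      -- parts peeled off at step `j`.
      s y X      : ℕ → Carrier
    p : Carrier
    p = q * p-quotient
    -- The ratio of consecutive numerators. Its explicit factor `q` makes the kth numerator
    -- divisible by `q ^ k`, so that the series may stop at k = `order`.
    r : ℕ → ℕ → Carrier
    r j k = p ^ j * (q * s k)
    d : ℕ → ℕ → Carrier
    d j k = t * p ^ (suc j ℕ.+ k)
    -- The first order recurrence for T_j is this polynomial identity, multiplied
    -- by the kth term of the series and summed over k.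
    field
      balance : ∀ j k →
        y j + z * p ^ k * X j + z * p ^ k * d j k ≈ z * p ^ k + r j k + y j * d j k

  module HypergeometricSum (P : Parameters) where
    open Parameters P

    p-small : Small p
    p-small = small p-quotient refl

    e : ℕ → ℕ → Carrier
    e j zero    = 1#
    e j (suc k) = e j k * r j k

    -- This is 1 / (t p^(j+1); p)_k, and `W k` is 1 / (zp; p)_k.
    D : ℕ → ℕ → Carrier
    D j zero    = 1#
    D j (suc k) = D j k * inv (d j k)

    W : ℕ → Carrier
    W zero    = 1#
    W (suc k) = W k * inv (z * p ^ suc k)

    -- `τ j k` is the kth term of `T j`, and `σ j k` is that term divided by 1 - d j k. `H j k`
    -- equals (1 - z p^(k+1)) times the next term; it is the quantity that telescopes.
    τ σ H : ℕ → ℕ → Carrier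
    τ j k = e j k * (D j k * W k)
    σ j k = e j k * (D j (suc k) * W k)
    H j k = r j k * σ j k

    T : ℕ → Carrier
    T j = ∑ (suc order) (τ j)

    e-shift : ∀ j k → e (suc j) k ≈ p ^ k * e j k
    e-shift j zero    = sym (*-identityˡ 1#)
    e-shift j (suc k) = trans (*-congʳ (e-shift j k))
      (solve 5 (λ p pk e pj s → (pk :* e) :* ((p :* pj) :* s) := (p :* pk) :* (e :* (pj :* s)))
        refl p (p ^ k) (e j k) (p ^ j) (q * s k))

    D-shift : ∀ j k → D j (suc k) ≈ inv (d j 0) * D (suc j) k
    D-shift j zero    = *-comm _ _
    D-shift j (suc k) = begin
      D j (suc k) * inv (d j (suc k))
        ≈⟨ *-cong (D-shift j k) (inv-cong (*-congˡ (^-congʳ p (≡.cong suc (ℕ.+-suc j k))))) ⟩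
      inv (d j 0) * D (suc j) k * inv (d (suc j) k)
        ≈⟨ *-assoc _ _ _ ⟩
      inv (d j 0) * D (suc j) (suc k) ∎

    d-small : ∀ j k → Small (d j k)
    d-small j k = *-small t (^-small (j ℕ.+ k) p-small)

    σ≈τ+dσ : ∀ j k → σ j k ≈ τ j k + d j k * σ j k
    σ≈τ+dσ j k = begin
      e j k * (D j k * inv (d j k) * W k)
        ≈⟨ *-congˡ (*-congʳ (*-congˡ (inv-unfold (d-small j k)))) ⟩
      e j k * (D j k * (1# + d j k * inv (d j k)) * W k)
        ≈⟨ solve 5 (λ e D d i W → e :* (D :* (con 1 :+ d :* i) :* W) :=
             e :* (D :* W) :+ d :* (e :* (D :* i :* W))) refl _ _ _ _ _ ⟩
      τ j k + d j k * σ j k ∎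

    τ-suc : ∀ j k → τ j (suc k) ≈ H j k + z * p ^ suc k * τ j (suc k)
    τ-suc j k = begin
      e j k * r j k * (D j (suc k) * (W k * i))
        ≈⟨ *-congˡ (*-congˡ (*-congˡ (inv-unfold (*-small z (^-small k p-small))))) ⟩
      e j k * r j k * (D j (suc k) * (W k * (1# + z * p ^ suc k * i)))
        ≈⟨ solve 6 (λ e r D W x i → e :* r :* (D :* (W :* (con 1 :+ x :* i))) :=
             r :* (e :* (D :* W)) :+ x :* (e :* r :* (D :* (W :* i)))) refl _ _ _ _ _ _ ⟩
      H j k + z * p ^ suc k * τ j (suc k) ∎
      where i = inv (z * p ^ suc k)

    -- Raising `j` drops the first factor of `D` and appends one at the end. Restoring the first
    -- factor leaves k + 1 factors, which gives `σ`; the numerators contribute `p ^ k`.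
    τ-shift : ∀ j k → inv (d j 0) * τ (suc j) k ≈ p ^ k * σ j k
    τ-shift j k = begin
      inv (d j 0) * (e (suc j) k * (D (suc j) k * W k))
        ≈⟨ *-congˡ (*-congʳ (e-shift j k)) ⟩
      inv (d j 0) * (p ^ k * e j k * (D (suc j) k * W k))
        ≈⟨ solve 5 (λ i p e D W → i :* (p :* e :* (D :* W)) := p :* (e :* (i :* D :* W)))
             refl _ _ _ _ _ ⟩
      p ^ k * (e j k * (inv (d j 0) * D (suc j) k * W k))
        ≈⟨ *-congˡ (*-congˡ (*-congʳ (D-shift j k))) ⟨
      p ^ k * σ j k ∎

    stepTerm : ℕ → ℕ → Carrier
    stepTerm j k = y j * τ j k + z * X j * (inv (d j 0) * τ (suc j) k)

    -- This is `balance` times `σ j k`. Since `τ` is (1 - d) `σ`, every term is a multiple of `σ`;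
    -- the summand passed to `+-cancelʳ` clears the negative multiples of d.
    stepTerm-telescopes : ∀ j k → stepTerm j k ≈ z * p ^ k * τ j k + H j k
    stepTerm-telescopes j k =
      trans (+-congˡ (*-congˡ (τ-shift j k)))
        (+-cancelʳ (y j * (d j k * σ j k) + z * p ^ k * (d j k * σ j k)) (begin
        (y j * τ j k + z * X j * (p ^ k * σ j k)) + (y j * (d j k * σ j k) + z * p ^ k * (d j k * σ j k))
          ≈⟨ solve 7 (λ y τ z X p σ d →
               (y :* τ :+ z :* X :* (p :* σ)) :+ (y :* (d :* σ) :+ z :* p :* (d :* σ)) :=
               y :* (τ :+ d :* σ) :+ (z :* p :* X :+ z :* p :* d) :* σ) refl _ _ _ _ _ _ _ ⟩
        y j * (τ j k + d j k * σ j k) + (z * p ^ k * X j + z * p ^ k * d j k) * σ j k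
          ≈⟨ +-congʳ (*-congˡ (σ≈τ+dσ j k)) ⟨
        y j * σ j k + (z * p ^ k * X j + z * p ^ k * d j k) * σ j k
          ≈⟨ solve 4 (λ y a b σ → y :* σ :+ (a :+ b) :* σ := (y :+ a :+ b) :* σ) refl _ _ _ _ ⟩
        (y j + z * p ^ k * X j + z * p ^ k * d j k) * σ j k
          ≈⟨ *-congʳ (balance j k) ⟩
        (z * p ^ k + r j k + y j * d j k) * σ j k
          ≈⟨ solve 5 (λ a r y d σ → (a :+ r :+ y :* d) :* σ :=
               a :* σ :+ (r :* σ :+ y :* (d :* σ))) refl _ _ _ _ _ ⟩
        z * p ^ k * σ j k + (r j k * σ j k + y j * (d j k * σ j k))
          ≈⟨ +-congʳ (*-congˡ (σ≈τ+dσ j k)) ⟩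
        z * p ^ k * (τ j k + d j k * σ j k) + (r j k * σ j k + y j * (d j k * σ j k))
          ≈⟨ solve 6 (λ a τ d σ r y → a :* (τ :+ d :* σ) :+ (r :* σ :+ y :* (d :* σ)) :=
               (a :* τ :+ r :* σ) :+ (y :* (d :* σ) :+ a :* (d :* σ))) refl _ _ _ _ _ _ ⟩
        (z * p ^ k * τ j k + H j k) + (y j * (d j k * σ j k) + z * p ^ k * (d j k * σ j k)) ∎))

    -- By `τ-suc`, z p^k τ_k is τ_k - H_(k-1) for k > 0, so all `H` but the last cancel. At k = 0
    -- the term is z where τ_0 = 1, hence the extra `z` and `1#`.
    partial-sum : ∀ j K → ∑ (suc K) (τ j) + z + H j K ≈ 1# + ∑ (suc K) (stepTerm j)
    partial-sum j zero = begin
      0# + τ j 0 + z + H j 0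
        ≈⟨ solve 2 (λ z h → con 0 :+ con 1 :* (con 1 :* con 1) :+ z :+ h :=
             con 1 :+ (con 0 :+ (z :* con 1 :* (con 1 :* (con 1 :* con 1)) :+ h))) refl z (H j 0) ⟩
      1# + (0# + (z * p ^ 0 * τ j 0 + H j 0))
        ≈⟨ +-congˡ (+-congˡ (stepTerm-telescopes j 0)) ⟨
      1# + (0# + stepTerm j 0) ∎
    partial-sum j (suc K) = begin
      ∑ (suc K) (τ j) + τ j (suc K) + z + H j (suc K)
        ≈⟨ +-congʳ (+-congʳ (+-congˡ (τ-suc j K))) ⟩
      ∑ (suc K) (τ j) + (H j K + z * p ^ suc K * τ j (suc K)) + z + H j (suc K)
        ≈⟨ solve 5 (λ a h b z h′ → a :+ (h :+ b) :+ z :+ h′ := (a :+ z :+ h) :+ (b :+ h′))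
             refl _ _ _ _ _ ⟩
      (∑ (suc K) (τ j) + z + H j K) + (z * p ^ suc K * τ j (suc K) + H j (suc K))
        ≈⟨ +-cong (partial-sum j K) (sym (stepTerm-telescopes j (suc K))) ⟩
      (1# + ∑ (suc K) (stepTerm j)) + stepTerm j (suc K)
        ≈⟨ +-assoc _ _ _ ⟩
      1# + ∑ (suc (suc K)) (stepTerm j) ∎

    e-divisible : ∀ j k → ∃ λ c → e j k ≈ q ^ k * c
    e-divisible j zero    = 1# , sym (*-identityˡ 1#)
    e-divisible j (suc k) with c , e≈ ← e-divisible j k =
      c * (p ^ j * s k) , trans (*-congʳ e≈)
        (solve 5 (λ qk c pj q s → qk :* c :* (pj :* (q :* s)) := q :* qk :* (c :* (pj :* s)))
          refl _ _ _ _ _)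

    -- The factor `r j order` advances the numerator to index order + 1, which is divisible by a
    -- vanishing power of `q`. The recurrence is therefore exact for the truncated series.
    H-last≈0 : ∀ j → H j order ≈ 0#
    H-last≈0 j with c , e≈ ← e-divisible j (suc order) = begin
      r j order * (e j order * rest)  ≈⟨ solve 3 (λ r e x → r :* (e :* x) := e :* r :* x) refl _ _ _ ⟩
      e j (suc order) * rest          ≈⟨ *-congʳ e≈ ⟩
      q ^ suc order * c * rest        ≈⟨ *-assoc _ _ _ ⟩
      q ^ suc order * (c * rest)      ≈⟨ q^n*x≈0 _ ℕ.≤-refl ⟩
      0#                              ∎
      where rest = D j (suc order) * W order

    T-recurrence : ∀ j → T j + z ≈ 1# + (y j * T j + z * X j * (inv (d j 0) * T (suc j)))
    T-recurrence j = begin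
      T j + z                                        ≈⟨ +-identityʳ _ ⟨
      T j + z + 0#                                   ≈⟨ +-congˡ (H-last≈0 j) ⟨
      T j + z + H j order                            ≈⟨ partial-sum j order ⟩
      1# + ∑ (suc order) (stepTerm j)                ≈⟨ +-congˡ (∑-+ (suc order) _ _) ⟩
      1# + (∑ (suc order) (λ k → y j * τ j k) + ∑ (suc order) (λ k → z * X j * (inv (d j 0) * τ (suc j) k)))
        ≈⟨ +-congˡ (+-cong (∑-distribˡ _ (suc order) _)
             (trans (∑-distribˡ _ (suc order) _) (*-congˡ (∑-distribˡ _ (suc order) _)))) ⟩
      1# + (y j * T j + z * X j * (inv (d j 0) * T (suc j))) ∎

    -- Every term after the first contains `p ^ suc order`, which is 0; the iteration of the
    -- recurrence can end here.
    T-last≈1 : T (suc order) ≈ 1#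
    T-last≈1 = begin
      ∑ (suc order) (τ N)                          ≈⟨ ∑-suc order (τ N) ⟩
      τ N 0 + ∑ order (λ k → τ N (suc k))          ≈⟨ +-congˡ (∑-zero order τ≈0) ⟩
      τ N 0 + 0#
        ≈⟨ solve 0 (con 1 :* (con 1 :* con 1) :+ con 0 := con 1) refl ⟩
      1# ∎
      where
      N = suc order
      τ≈0 : ∀ k → τ N (suc k) ≈ 0#
      τ≈0 k = begin
        e N k * (p ^ N * (q * s k)) * (D N (suc k) * W (suc k))
          ≈⟨ *-congʳ (*-congˡ (*-congʳ (small^N≈0 p-small))) ⟩
        e N k * (0# * (q * s k)) * (D N (suc k) * W (suc k))
          ≈⟨ solve 3 (λ e s w → e :* (con 0 :* s) :* w := con 0) refl _ _ _ ⟩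
        0# ∎

    -- `B` is a summation factor for the recurrence, with `A` standing for B / (1 - y). In the
    -- applications `B j` enumerates the overpartitions with parts below a bound growing with `j`,
    -- `A j` admits in addition the non-overlined part of weight `y j`, and `F j` enumerates by rank
    -- under the same bound as `B j`.
    module _ (A B F : ℕ → Carrier) (B₀≈1 : B 0 ≈ 1#) (F₀≈1 : F 0 ≈ 1#)
             (A-unfold : ∀ j → A j ≈ B j + y j * A j)
             (B-suc : ∀ j → B (suc j) ≈ X j * (inv (d j 0) * A j))
             (F-suc : ∀ j → F (suc j) + (z * z ^ j * A j + z ^ j * B j) ≈
                            F j + (z ^ j * A j + z * z ^ j * B (suc j))) where

      -- The recurrence times `A j`: on the left (1 - y j) A j is `B j`, and on the right `B-suc`
      -- absorbs the remaining coefficients. Adding `y j * A j * T j` avoids the subtraction.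
      BT-recurrence : ∀ j → B j * T j + z * A j ≈ A j + z * (B (suc j) * T (suc j))
      BT-recurrence j = +-cancelʳ (y j * A j * T j) (begin
        B j * T j + z * A j + y j * A j * T j
          ≈⟨ solve 5 (λ B T z A c → B :* T :+ z :* A :+ c :* T := (B :+ c) :* T :+ z :* A)
               refl _ _ _ _ _ ⟩
        (B j + y j * A j) * T j + z * A j
          ≈⟨ +-congʳ (*-congʳ (A-unfold j)) ⟨
        A j * T j + z * A j
          ≈⟨ solve 3 (λ A T z → A :* T :+ z :* A := A :* (T :+ z)) refl _ _ _ ⟩
        A j * (T j + z)
          ≈⟨ *-congˡ (T-recurrence j) ⟩
        A j * (1# + (y j * T j + z * X j * (inv (d j 0) * T (suc j))))
          ≈⟨ solve 7 (λ A y T z X i T′ → A :* (con 1 :+ (y :* T :+ z :* X :* (i :* T′))) :=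
               A :+ z :* (X :* (i :* A) :* T′) :+ y :* A :* T) refl _ _ _ _ _ _ _ ⟩
        A j + z * (X j * (inv (d j 0) * A j) * T (suc j)) + y j * A j * T j
          ≈⟨ +-congʳ (+-congˡ (*-congˡ (*-congʳ (B-suc j)))) ⟨
        A j + z * (B (suc j) * T (suc j)) + y j * A j * T j ∎)

      -- `BT-recurrence` weighted by `z ^ j` and summed; `F` is chosen to collect the inhomogeneous
      -- terms. Once `T j` is 1, the terms next to `T 0` and `F j` cancel.
      T₀-partial : ∀ j → T 0 + z ^ j * B j ≈ F j + z ^ j * (B j * T j)
      T₀-partial zero = begin
        T 0 + 1# * B 0          ≈⟨ +-congˡ (*-congˡ B₀≈1) ⟩
        T 0 + 1# * 1#           ≈⟨ solve 1 (λ T → T :+ con 1 :* con 1 := con 1 :+ con 1 :* (con 1 :* T)) refl _ ⟩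
        1# + 1# * (1# * T 0)    ≈⟨ +-cong F₀≈1 (*-congˡ (*-congʳ B₀≈1)) ⟨
        F 0 + 1# * (B 0 * T 0)  ∎
      T₀-partial (suc j) = +-cancelʳ (F j + Z * A j + Z * (B j * T j) + z * Z * A j) (begin
        T 0 + z * Z * B (suc j) + (F j + Z * A j + Z * (B j * T j) + z * Z * A j)
          ≈⟨ solve 6 (λ T b F a c d → T :+ b :+ (F :+ a :+ c :+ d) := T :+ (F :+ (a :+ b)) :+ (c :+ d))
               refl _ _ _ _ _ _ ⟩
        T 0 + (F j + (Z * A j + z * Z * B (suc j))) + (Z * (B j * T j) + z * Z * A j)
          ≈⟨ +-cong (+-congˡ (F-suc j))
               (solve 4 (λ Z b z A → Z :* (b :+ z :* A) := Z :* b :+ z :* Z :* A) refl _ _ _ _) ⟨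
        T 0 + (F (suc j) + (z * Z * A j + Z * B j)) + Z * (B j * T j + z * A j)
          ≈⟨ +-congˡ (*-congˡ (BT-recurrence j)) ⟩
        T 0 + (F (suc j) + (z * Z * A j + Z * B j)) + Z * (A j + z * (B (suc j) * T (suc j)))
          ≈⟨ solve 5 (λ T F c b a → T :+ (F :+ (c :+ b)) :+ a := (T :+ b) :+ (F :+ c :+ a))
               refl _ _ _ _ _ ⟩
        T 0 + Z * B j + (F (suc j) + z * Z * A j + Z * (A j + z * (B (suc j) * T (suc j))))
          ≈⟨ +-congʳ (T₀-partial j) ⟩
        F j + Z * (B j * T j) + (F (suc j) + z * Z * A j + Z * (A j + z * (B (suc j) * T (suc j))))
          ≈⟨ solve 7 (λ F b F′ z Z A c → F :+ b :+ (F′ :+ z :* Z :* A :+ Z :* (A :+ z :* c)) :=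
               F′ :+ z :* Z :* c :+ (F :+ Z :* A :+ b :+ z :* Z :* A)) refl _ _ _ _ _ _ _ ⟩
        F (suc j) + z * Z * (B (suc j) * T (suc j)) + (F j + Z * A j + Z * (B j * T j) + z * Z * A j) ∎)
        where Z = z ^ j

      T₀≈F : T 0 ≈ F (suc order)
      T₀≈F = +-cancelʳ (z ^ N * B N) (begin
        T 0 + z ^ N * B N            ≈⟨ T₀-partial N ⟩
        F N + z ^ N * (B N * T N)    ≈⟨ +-congˡ (*-congˡ (*-congˡ T-last≈1)) ⟩
        F N + z ^ N * (B N * 1#)     ≈⟨ +-congˡ (*-congˡ (*-identityʳ _)) ⟩
        F N + z ^ N * B N            ∎)
        where N = suc order

-- Enumeration of overpartitions by weight

mayFollow : ℕ → ℕ × Bool → Bool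
mayFollow p (i , c) = (i ≤ᵇ p) ∧ (not (p ≡ᵇ i) ∨ not c) ∧ (1 ≤ᵇ i)

validAfter : ℕ → Cand → Bool
validAfter p []      = true
validAfter p (x ∷ l) = mayFollow p x ∧ validAfter (proj₁ x) l

-- `mayFollow` also tests that the following part is positive, so the condition on the rest depends
-- only on the preceding size, not on its overline.
valid-∷ : ∀ p b l → valid ((p , b) ∷ l) ≡ (1 ≤ᵇ p) ∧ validAfter p l
valid-∷ zero    b []            = ≡.refl
valid-∷ (suc p) b []            = ≡.refl
valid-∷ zero    b ((i , c) ∷ l) = ≡.refl
valid-∷ (suc p) b ((i , c) ∷ l) rewrite valid-∷ i c l with i ≤ᵇ suc p
... | false = ≡.refl
... | true with not (suc p ≡ᵇ i) ∨ not c
...   | false = ≡.refl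
...   | true  = ≡.refl

≤ᵇ-true : ∀ {m n} → m ℕ.≤ n → (m ≤ᵇ n) ≡ true
≤ᵇ-true {m} {n} m≤n with m ≤ᵇ n | ℕ.≤⇒≤ᵇ m≤n
... | true | _ = ≡.refl

≤ᵇ-false : ∀ {m n} → n ℕ.< m → (m ≤ᵇ n) ≡ false
≤ᵇ-false {m} {n} n<m with m ≤ᵇ n in eq
... | false = ≡.refl
... | true  = ⊥-elim (ℕ.<⇒≱ n<m (ℕ.≤ᵇ⇒≤ m n (≡.subst Bool.T (≡.sym eq) tt)))

≡ᵇ-refl : ∀ n → (n ≡ᵇ n) ≡ true
≡ᵇ-refl zero    = ≡.refl
≡ᵇ-refl (suc n) = ≡ᵇ-refl n

≡ᵇ-false : ∀ {m n} → n ℕ.< m → (m ≡ᵇ n) ≡ false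
≡ᵇ-false {suc m} {zero}  _         = ≡.refl
≡ᵇ-false {suc m} {suc n} (s≤s n<m) = ≡ᵇ-false n<m

mayFollow-< : ∀ {p i} b → i ℕ.< p → mayFollow (suc p) (suc i , b) ≡ true
mayFollow-< {p} {i} b i<p
  rewrite ≤ᵇ-true (s≤s (ℕ.<⇒≤ i<p)) | ≡ᵇ-false i<p = ≡.refl

mayFollow-≡ : ∀ p b → mayFollow (suc p) (suc p , b) ≡ not b
mayFollow-≡ p b rewrite ≤ᵇ-true (ℕ.≤-refl {suc p}) | ≡ᵇ-refl p with b
... | true  = ≡.refl
... | false = ≡.refl

mayFollow-> : ∀ {p i} b → p ℕ.< i → mayFollow (suc p) (suc i , b) ≡ false
mayFollow-> {p} {i} b p<i rewrite ≤ᵇ-false (s≤s p<i) = ≡.refl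

module Overpartitions (S : LaurentTruncation) where
  open Truncated S
  open Relation.Binary.Reasoning.Setoid setoid

  -- Sums over words of bounded length.

  infixr 8 [_]_
  [_]_ : Bool → Carrier → Carrier
  [ b ] x = if b then x else 0#

  []-* : ∀ b x y → [ b ] (x * y) ≈ x * [ b ] y
  []-* true  x y = refl
  []-* false x y = sym (zeroʳ x)

  sumOver : {A : Set} → (A → Carrier) → List A → Carrier
  sumOver f []       = 0#
  sumOver f (x ∷ xs) = f x + sumOver f xs

  module _ {A : Set} where

    sumOver-cong : {f g : A → Carrier} → (∀ x → f x ≈ g x) → ∀ xs → sumOver f xs ≈ sumOver g xs
    sumOver-cong f≈g []       = refl
    sumOver-cong f≈g (x ∷ xs) = +-cong (f≈g x) (sumOver-cong f≈g xs)

    sumOver-distribˡ : ∀ c (f : A → Carrier) xs → sumOver (λ x → c * f x) xs ≈ c * sumOver f xs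
    sumOver-distribˡ c f []       = sym (zeroʳ c)
    sumOver-distribˡ c f (x ∷ xs) = trans (+-congˡ (sumOver-distribˡ c f xs)) (sym (distribˡ c _ _))

    sumOver-++ : ∀ (f : A → Carrier) xs ys → sumOver f (xs ++ ys) ≈ sumOver f xs + sumOver f ys
    sumOver-++ f []       ys = sym (+-identityˡ _)
    sumOver-++ f (x ∷ xs) ys = trans (+-congˡ (sumOver-++ f xs ys)) (sym (+-assoc _ _ _))

    sumOver-map : ∀ {B : Set} (f : A → Carrier) (g : B → A) xs →
                  sumOver f (map g xs) ≈ sumOver (λ x → f (g x)) xs
    sumOver-map f g []       = refl
    sumOver-map f g (x ∷ xs) = +-congˡ (sumOver-map f g xs)

    sumOver-concatMap : ∀ {B : Set} (f : A → Carrier) (g : B → List A) xs →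
                        sumOver f (concatMap g xs) ≈ sumOver (λ x → sumOver f (g x)) xs
    sumOver-concatMap f g []       = refl
    sumOver-concatMap f g (x ∷ xs) =
      trans (sumOver-++ f (g x) _) (+-congˡ (sumOver-concatMap f g xs))

    sumOver-applyUpTo : ∀ (f : A → Carrier) (g : ℕ → A) n →
                        sumOver f (applyUpTo g n) ≈ ∑ n (λ i → f (g i))
    sumOver-applyUpTo f g zero    = refl
    sumOver-applyUpTo f g (suc n) =
      trans (+-congˡ (sumOver-applyUpTo f (λ i → g (suc i)) n)) (sym (∑-suc n _))

  sumOver-words : ∀ {A : Set} (f : List A → Carrier) xs L →
    sumOver f (words xs (suc L)) ≈ f [] + sumOver (λ x → sumOver (λ l → f (x ∷ l)) (words xs L)) xs
  sumOver-words f xs L = +-congˡ (trans (sumOver-concatMap f _ xs)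
    (sumOver-cong (λ x → sumOver-map f (x ∷_) (words xs L)) xs))

  sumOver-letters : ∀ (f : ℕ × Bool → Carrier) n →
    sumOver f (letters n) ≈ ∑ n (λ i → f (suc i , false) + f (suc i , true))
  sumOver-letters f n = trans (sumOver-concatMap f _ (applyUpTo suc n))
    (trans (sumOver-applyUpTo _ suc n)
      (∑-cong n (λ i → +-congˡ (+-identityʳ _))))

  ∑-initial : ∀ {p n} (f g : ℕ → Carrier) {c} → p ℕ.< n → (∀ i → i ℕ.< p → f i ≈ g i) →
              f p ≈ c → (∀ i → p ℕ.< i → f i ≈ 0#) → ∑ n f ≈ ∑ p g + c
  ∑-initial {p} f g p<n f≈g fp≈c f≈0 =
    trans (∑-truncate f p<n f≈0) (+-cong (∑-cong< p f≈g) fp≈c)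

  -- Both ranks are additive over the parts up to a correction depending on the first part alone:
  -- `u` weighs each part and `h` is the correction.
  module Weighted (u h : ℕ × Bool → Carrier) where

    w η : ℕ × Bool → Carrier
    w x = u x * q ^ proj₁ x
    η x = h x * w x

    monomial rankMonomial : Cand → Carrier
    monomial []      = 1#
    monomial (x ∷ l) = w x * monomial l
    rankMonomial []      = 1#
    rankMonomial (x ∷ l) = h x * monomial (x ∷ l)

    -- partsUpTo p enumerates the overpartitions with parts at most p, and
    -- tails p the possible continuations of a part of size p + 1.
    partsUpTo tails : ℕ → Carrier
    partsUpTo zero    = 1#
    partsUpTo (suc p) = (1# + w (suc p , true)) * tails p
    tails p = inv (w (suc p , false)) * partsUpTo p

    -- Sorted by first part. Both flags share the factor `tails i`, since a further part of the same
    -- size must be non-overlined in either case.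
    rankSum : ℕ → Carrier
    rankSum n = 1# + ∑ n (λ i → (η (suc i , false) + η (suc i , true)) * tails i)

    w-small : ∀ i b → Small (w (suc i , b))
    w-small i b = *-small _ (^-small i q-small)

    tails-unfold : ∀ p → tails p ≈ partsUpTo p + w (suc p , false) * tails p
    tails-unfold p = trans (*-congʳ (inv-unfold (w-small p false)))
      (solve 3 (λ x i a → (con 1 :+ x :* i) :* a := a :+ x :* (i :* a)) refl _ _ _)

    -- Sorts what follows a part p + 1 by its next part: nothing, a smaller part with either flag,
    -- or an equal part, which cannot be overlined. `tails` is a fixed point.
    continuations : ℕ → (ℕ → Carrier) → Carrier
    continuations p A =
      1# + (∑ p (λ i → (w (suc i , false) + w (suc i , true)) * A i) + w (suc p , false) * A p)

    partsUpTo-sum : ∀ p → partsUpTo p ≈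
      1# + ∑ p (λ i → (w (suc i , false) + w (suc i , true)) * tails i)
    partsUpTo-sum zero    = sym (+-identityʳ 1#)
    partsUpTo-sum (suc p) = begin
      (1# + w (suc p , true)) * tails p
        ≈⟨ solve 2 (λ v t → (con 1 :+ v) :* t := t :+ v :* t) refl _ _ ⟩
      tails p + w (suc p , true) * tails p
        ≈⟨ +-congʳ (trans (tails-unfold p) (+-congʳ (partsUpTo-sum p))) ⟩
      1# + ∑ p _ + w (suc p , false) * tails p + w (suc p , true) * tails p
        ≈⟨ solve 5 (λ o s a b t → o :+ s :+ a :* t :+ b :* t := o :+ (s :+ (a :+ b) :* t)) refl _ _ _ _ _ ⟩
      1# + (∑ p _ + (w (suc p , false) + w (suc p , true)) * tails p) ∎

    tails-fixpoint : ∀ p → tails p ≈ continuations p tails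
    tails-fixpoint p =
      trans (tails-unfold p) (trans (+-congʳ (partsUpTo-sum p)) (+-assoc _ _ _))

    small-cong : ∀ {x} k → Small x → ∀ {A A′} → q ^ suc k * A ≈ q ^ suc k * A′ →
                 q ^ k * (x * A) ≈ q ^ k * (x * A′)
    small-cong k (small y x≈qy) {A} {A′} A≈A′ =
      trans (pull A) (trans (*-congˡ A≈A′) (sym (pull A′)))
      where
      pull : ∀ C → q ^ k * (_ * C) ≈ y * (q ^ suc k * C)
      pull C = trans (*-congˡ (*-congʳ x≈qy))
        (solve 4 (λ qk q y C → qk :* (q :* y :* C) := y :* (q :* qk :* C)) refl _ _ _ _)

    +-small : ∀ {x y} → Small x → Small y → Small (x + y)
    +-small (small a x≈qa) (small b y≈qb) =
      small (a + b) (trans (+-cong x≈qa y≈qb) (sym (distribˡ q a b)))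

    weighted-sum-cong : ∀ k n (x : ℕ → Carrier) → (∀ i → Small (x i)) → {A A′ : ℕ → Carrier} →
      (∀ i → i ℕ.< n → q ^ suc k * A i ≈ q ^ suc k * A′ i) →
      q ^ k * ∑ n (λ i → x i * A i) ≈ q ^ k * ∑ n (λ i → x i * A′ i)
    weighted-sum-cong k n x x-small A≈A′ =
      trans (sym (∑-distribˡ _ n _))
        (trans (∑-cong< n (λ i i<n → small-cong k (x-small i) (A≈A′ i i<n))) (∑-distribˡ _ n _))

    -- A q-adic contraction: each occurrence of `A` carries a small weight, so one application gains
    -- one power of `q`. This is what lets finite words approximate the fixed point.
    continuations-cong : ∀ k p {A A′ : ℕ → Carrier} → (∀ i → i ℕ.≤ p → q ^ suc k * A i ≈ q ^ suc k * A′ i) →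
                         q ^ k * continuations p A ≈ q ^ k * continuations p A′
    continuations-cong k p A≈A′ = trans (expand _) (trans
      (+-congˡ (+-cong
        (weighted-sum-cong k p _ (λ i → +-small (w-small i false) (w-small i true))
          (λ i i<p → A≈A′ i (ℕ.<⇒≤ i<p)))
        (small-cong k (w-small p false) (A≈A′ p ℕ.≤-refl)))) (sym (expand _)))
      where
      expand : ∀ A → q ^ k * continuations p A ≈ _
      expand A = solve 4 (λ q o a b → q :* (o :+ (a :+ b)) := q :* o :+ (q :* a :+ q :* b)) refl _ _ _ _

    enumerated : ℕ → ℕ → Carrier
    enumerated p L = sumOver (λ l → [ validAfter p l ] monomial l) (words (letters order) L)

    enumerated-suc : ∀ p L → p ℕ.< order →
      enumerated (suc p) (suc L) ≈ continuations p (λ i → enumerated (suc i) L)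
    enumerated-suc p L p<order = trans (sumOver-words _ (letters order) L) (+-congˡ (begin
      sumOver (λ x → sumOver (λ l → [ mayFollow (suc p) x ∧ validAfter (proj₁ x) l ] (w x * monomial l)) ws)
              (letters order)
        ≈⟨ sumOver-cong byFirst (letters order) ⟩
      sumOver (λ x → [ mayFollow (suc p) x ] (w x * enumerated (proj₁ x) L)) (letters order)
        ≈⟨ sumOver-letters _ order ⟩
      ∑ order (λ i → allowed i false + allowed i true)
        ≈⟨ ∑-initial _ _ p<order below at above ⟩
      _ ∎))
      where
      ws = words (letters order) L
      byFirst : ∀ x → sumOver (λ l → [ mayFollow (suc p) x ∧ validAfter (proj₁ x) l ] (w x * monomial l)) ws
                      ≈ [ mayFollow (suc p) x ] (w x * enumerated (proj₁ x) L)
      byFirst x with mayFollow (suc p) x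
      ... | true  = trans (sumOver-cong (λ l → []-* (validAfter (proj₁ x) l) _ _) ws)
                      (sumOver-distribˡ (w x) _ ws)
      ... | false = trans (sumOver-cong (λ l → sym (zeroˡ 0#)) ws)
                      (trans (sumOver-distribˡ 0# (λ _ → 0#) ws) (zeroˡ _))
      allowed : ℕ → Bool → Carrier
      allowed i b = [ mayFollow (suc p) (suc i , b) ] (w (suc i , b) * enumerated (suc i) L)
      below : ∀ i → i ℕ.< p →
        allowed i false + allowed i true ≈ (w (suc i , false) + w (suc i , true)) * enumerated (suc i) L
      below i i<p rewrite mayFollow-< false i<p | mayFollow-< true i<p = sym (distribʳ _ _ _)
      at : allowed p false + allowed p true ≈ w (suc p , false) * enumerated (suc p) L
      at rewrite mayFollow-≡ p false | mayFollow-≡ p true = +-identityʳ _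
      above : ∀ i → p ℕ.< i → allowed i false + allowed i true ≈ 0#
      above i p<i rewrite mayFollow-> false p<i | mayFollow-> true p<i = +-identityʳ _

    -- Words of length at most L determine the series only up to q ^ L, which
    -- the factor q ^ k accounts for.
    enumerated≈tails : ∀ L k p → p ℕ.< order → order ℕ.≤ k ℕ.+ L →
      q ^ k * enumerated (suc p) L ≈ q ^ k * tails p
    enumerated≈tails zero k p p<order order≤k+L = begin
      q ^ k * (1# + 0#)
        ≈⟨ *-congˡ (+-congˡ (trans (+-cong (∑-zero p (λ i → zeroʳ _)) (zeroʳ _)) (+-identityʳ 0#))) ⟨
      q ^ k * continuations p (λ _ → 0#)
        ≈⟨ continuations-cong k p (λ i _ → trans (q^n*x≈0 _ order≤k) (sym (q^n*x≈0 _ order≤k))) ⟩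
      q ^ k * continuations p tails
        ≈⟨ *-congˡ (tails-fixpoint p) ⟨
      q ^ k * tails p ∎
      where
      order≤k : order ℕ.< suc k
      order≤k = s≤s (≡.subst (order ℕ.≤_) (ℕ.+-identityʳ k) order≤k+L)
    enumerated≈tails (suc L) k p p<order order≤k+L = begin
      q ^ k * enumerated (suc p) (suc L)
        ≈⟨ *-congˡ (enumerated-suc p L p<order) ⟩
      q ^ k * continuations p (λ i → enumerated (suc i) L)
        ≈⟨ continuations-cong k p (λ i i≤p → enumerated≈tails L (suc k) i (ℕ.≤-<-trans i≤p p<order)
             (≡.subst (order ℕ.≤_) (ℕ.+-suc k L) order≤k+L)) ⟩
      q ^ k * continuations p tails
        ≈⟨ *-congˡ (tails-fixpoint p) ⟨
      q ^ k * tails p ∎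

    validSum : ℕ → Carrier
    validSum L = sumOver (λ l → [ valid l ] rankMonomial l) (words (letters order) L)

    validSum-suc : ∀ L → validSum (suc L) ≈
      1# + ∑ order (λ i → (η (suc i , false) + η (suc i , true)) * enumerated (suc i) L)
    validSum-suc L = trans (sumOver-words _ (letters order) L) (+-congˡ (trans
      (sumOver-letters _ order)
      (∑-cong order (λ i → trans (+-cong (byFirst i false) (byFirst i true)) (sym (distribʳ _ _ _))))))
      where
      ws = words (letters order) L
      byFirst : ∀ i b → sumOver (λ l → [ valid ((suc i , b) ∷ l) ] rankMonomial ((suc i , b) ∷ l)) ws ≈
                        η (suc i , b) * enumerated (suc i) L
      byFirst i b = trans (sumOver-cong each ws) (sumOver-distribˡ (η (suc i , b)) _ ws)
        where
        each : ∀ l → [ valid ((suc i , b) ∷ l) ] rankMonomial ((suc i , b) ∷ l) ≈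
                     η (suc i , b) * [ validAfter (suc i) l ] monomial l
        each l rewrite valid-∷ (suc i) b l with validAfter (suc i) l
        ... | true  = sym (*-assoc _ _ _)
        ... | false = sym (zeroʳ _)

    η-small : ∀ i b → Small (η (suc i , b))
    η-small i b = *-small _ (w-small i b)

    validSum≈rankSum : ∀ L → L ≡ order → validSum L ≈ rankSum order
    validSum≈rankSum zero    ≡.refl = refl
    validSum≈rankSum (suc L) ≡.refl = trans (validSum-suc L) (+-congˡ
      (trans (sym (*-identityˡ _)) (trans
        (weighted-sum-cong 0 order _ (λ i → +-small (η-small i false) (η-small i true))
          -- The weight of the first part supplies one factor `q`, hence k = 1, and the remaining
          -- order - 1 letters suffice.
          (λ i i<order → enumerated≈tails L 1 i i<order ℕ.≤-refl))
        (*-identityˡ _))))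

    w≈0 : ∀ i b → order ℕ.≤ i → w (suc i , b) ≈ 0#
    w≈0 i b order≤i = trans (*-congˡ (q^n≈0 (s≤s order≤i))) (zeroʳ _)

    rankSum-stable : ∀ {n} → order ℕ.≤ n → rankSum n ≈ rankSum order
    rankSum-stable order≤n = +-congˡ (∑-truncate _ order≤n (λ i order≤i →
      trans (*-congʳ (+-cong (*-congˡ (w≈0 i false order≤i)) (*-congˡ (w≈0 i true order≤i))))
        (solve 3 (λ a b c → (a :* con 0 :+ b :* con 0) :* c := con 0) refl _ _ _)))

-- The two rank generating functions

module DRankIdentity (S : LaurentTruncation) where
  open Truncated S
  open Relation.Binary.Reasoning.Setoid setoid
  open Overpartitions S

  parameters : Parameters
  parameters = record
    { p-quotient = 1#
    -- This makes the numerators (-1; q)_k q^(k(k+1)/2) at j = 0.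
    ; s = λ k → p ^ k * (1# + p ^ k)
    ; y = λ _ → 0#
    ; X = λ j → 1# + t * (p * p ^ j)
    ; balance = balance
    }
    where
    p = q * 1#
    balance : ∀ j k →
      0# + z * p ^ k * (1# + t * (p * p ^ j)) + z * p ^ k * (t * p ^ (suc j ℕ.+ k)) ≈
      z * p ^ k + p ^ j * (q * (p ^ k * (1# + p ^ k))) + 0# * (t * p ^ (suc j ℕ.+ k))
    balance j k = begin
      0# + z * K * (1# + t * (p * J)) + z * K * (t * p ^ (suc j ℕ.+ k))
        ≈⟨ +-congˡ (*-congˡ (*-congˡ (^-homo-* p (suc j) k))) ⟩
      0# + z * K * (1# + t * (p * J)) + z * K * (t * (p * J * K))
        ≈⟨ solve 5 (λ z t q J K →
             con 0 :+ z :* K :* (con 1 :+ t :* (q :* con 1 :* J)) :+ z :* K :* (t :* (q :* con 1 :* J :* K)) :=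
             z :* K :+ z :* t :* (J :* (q :* (K :* (con 1 :+ K))))) refl z t q J K ⟩
      z * K + z * t * (J * (q * (K * (1# + K))))
        ≈⟨ +-congˡ (*-congʳ z*t≈1) ⟩
      z * K + 1# * (J * (q * (K * (1# + K))))
        ≈⟨ solve 3 (λ a b c → a :+ con 1 :* b := a :+ b :+ con 0 :* c) refl _ _ _ ⟩
      z * K + J * (q * (K * (1# + K))) + 0# * (t * p ^ (suc j ℕ.+ k)) ∎
      where
      J = p ^ j
      K = p ^ k

  open Parameters parameters public
  open HypergeometricSum parameters public
  -- Each part lowers the D-rank by one, and the first part raises it by its size.
  open Weighted (λ _ → t) (λ x → z ^ proj₁ x) public

  -- Overpartitions with largest part j + 1 contribute z^(j+1) times the increment of `partsUpTo`.
  -- The two terms `z ^ j * partsUpTo j` are the general `A` and `B` terms, which coincide here.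
  rankSum-suc : ∀ j → rankSum (suc j) + (z * z ^ j * partsUpTo j + z ^ j * partsUpTo j) ≈
                      rankSum j + (z ^ j * partsUpTo j + z * z ^ j * partsUpTo (suc j))
  rankSum-suc j = begin
    1# + (R + (Z * v + Z * v) * tails j) + (Z * a + z ^ j * a)
      ≈⟨ solve 6 (λ R Z v s a Y → con 1 :+ (R :+ (Z :* v :+ Z :* v) :* s) :+ (Z :* a :+ Y :* a) :=
           con 1 :+ R :+ (Y :* a :+ Z :* ((a :+ v :* s) :+ v :* s))) refl R Z v (tails j) a (z ^ j) ⟩
    1# + R + (z ^ j * a + Z * ((a + v * tails j) + v * tails j))
      ≈⟨ +-congˡ (+-congˡ (*-congˡ (+-congʳ (tails-unfold j)))) ⟨
    1# + R + (z ^ j * a + Z * (tails j + v * tails j))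
      ≈⟨ +-congˡ (+-congˡ (*-congˡ (solve 2 (λ v s → (con 1 :+ v) :* s := s :+ v :* s) refl _ _))) ⟨
    1# + R + (z ^ j * a + Z * partsUpTo (suc j)) ∎
    where
    R = ∑ j (λ i → (η (suc i , false) + η (suc i , true)) * tails i)
    Z = z * z ^ j
    v = w (suc j , false)
    a = partsUpTo j

  T₀≈validSum : T 0 ≈ validSum order
  T₀≈validSum = begin
    T 0
      -- With `y` = 0 the sequences `A` and `B` agree, and each step handles a single part size.
      ≈⟨ T₀≈F partsUpTo partsUpTo rankSum refl (+-identityʳ 1#)
           (λ j → sym (trans (+-congˡ (zeroˡ _)) (+-identityʳ _)))
           (λ j → *-cong (+-congˡ (*-congˡ (^-congˡ (suc j) (sym (*-identityʳ q)))))
             (*-congʳ (inv-cong (*-congˡ (trans (^-congˡ (suc j) (sym (*-identityʳ q)))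
               (^-congʳ p (≡.sym (ℕ.+-identityʳ (suc j)))))))))
           rankSum-suc ⟩
    rankSum (suc order)  ≈⟨ rankSum-stable (ℕ.n≤1+n order) ⟩
    rankSum order        ≈⟨ validSum≈rankSum order ≡.refl ⟨
    validSum order       ∎

-- The M₂-rank and the parity of parts.

isPlainOdd : ℕ × Bool → Bool
isPlainOdd (p , b) = not b ∧ not (p ℕ.% 2 ≡ᵇ 0)

-- Recursive, so that remainders, halves and sums at `double (suc j)` unfold by two steps of
-- computation.
double : ℕ → ℕ
double zero    = zero
double (suc n) = suc (suc (double n))

n≤double[n] : ∀ n → n ℕ.≤ double n
n≤double[n] zero    = z≤n
n≤double[n] (suc n) = s≤s (ℕ.m≤n⇒m≤1+n (n≤double[n] n))

isPlainOdd-even : ∀ n b → isPlainOdd (double n , b) ≡ false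
isPlainOdd-even n       true  = ≡.refl
isPlainOdd-even zero    false = ≡.refl
isPlainOdd-even (suc n) false = isPlainOdd-even n false

isPlainOdd-odd : ∀ n → isPlainOdd (suc (double n) , false) ≡ true
isPlainOdd-odd zero    = ≡.refl
isPlainOdd-odd (suc n) = isPlainOdd-odd n

⌊double/2⌋ : ∀ n → ⌊ double n /2⌋ ≡ n
⌊double/2⌋ zero    = ≡.refl
⌊double/2⌋ (suc n) = ≡.cong suc (⌊double/2⌋ n)

⌈double/2⌉ : ∀ n → ⌈ double n /2⌉ ≡ n
⌈double/2⌉ zero    = ≡.refl
⌈double/2⌉ (suc n) = ≡.cong suc (⌈double/2⌉ n)

module M2RankIdentity (S : LaurentTruncation) where
  open Truncated S
  open Relation.Binary.Reasoning.Setoid setoid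
  open Overpartitions S

  parameters : Parameters
  parameters = record
    { p-quotient = q
    -- This makes the numerators (-1; q)_(2k) q^k at j = 0.
    ; s = λ k → (1# + p ^ k) * (1# + q * p ^ k)
    ; y = λ j → q * p ^ j
    ; X = λ j → (1# + t * (p * p ^ j)) * (1# + t * (q * p ^ j))
    ; balance = balance
    }
    where
    p = q * q
    balance : ∀ j k →
      q * p ^ j + z * p ^ k * ((1# + t * (p * p ^ j)) * (1# + t * (q * p ^ j)))
        + z * p ^ k * (t * p ^ (suc j ℕ.+ k)) ≈
      z * p ^ k + p ^ j * (q * ((1# + p ^ k) * (1# + q * p ^ k)))
        + q * p ^ j * (t * p ^ (suc j ℕ.+ k))
    balance j k = begin
      q * J + z * K * ((1# + t * (p * J)) * (1# + t * (q * J))) + z * K * (t * p ^ (suc j ℕ.+ k))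
        ≈⟨ +-congˡ (*-congˡ (*-congˡ (^-homo-* p (suc j) k))) ⟩
      q * J + z * K * ((1# + t * (p * J)) * (1# + t * (q * J))) + z * K * (t * (p * J * K))
        ≈⟨ solve 5 (λ z t q J K →
             q :* J :+ z :* K :* ((con 1 :+ t :* (q :* q :* J)) :* (con 1 :+ t :* (q :* J)))
               :+ z :* K :* (t :* (q :* q :* J :* K)) :=
             z :* K :+ q :* J :+ z :* t :* (J :* K :* q :* (con 1 :+ q :+ q :* K :+ t :* q :* q :* J)))
             refl z t q J K ⟩
      z * K + q * J + z * t * (J * K * q * (1# + q + q * K + t * q * q * J))
        ≈⟨ +-congˡ (*-congʳ z*t≈1) ⟩
      z * K + q * J + 1# * (J * K * q * (1# + q + q * K + t * q * q * J))
        ≈⟨ solve 5 (λ z t q J K →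
             z :* K :+ q :* J :+ con 1 :* (J :* K :* q :* (con 1 :+ q :+ q :* K :+ t :* q :* q :* J)) :=
             z :* K :+ J :* (q :* ((con 1 :+ K) :* (con 1 :+ q :* K))) :+ q :* J :* (t :* (q :* q :* J :* K)))
             refl z t q J K ⟩
      z * K + J * (q * ((1# + K) * (1# + q * K))) + q * J * (t * (p * J * K))
        ≈⟨ +-congˡ (*-congˡ (*-congˡ (^-homo-* p (suc j) k))) ⟨
      z * K + J * (q * ((1# + K) * (1# + q * K))) + q * J * (t * p ^ (suc j ℕ.+ k)) ∎
      where
      J = p ^ j
      K = p ^ k

  open Parameters parameters public
  open HypergeometricSum parameters public

  -- A non-overlined odd part is counted in both the length and the number of such parts, so its net
  -- weight is 1. The factor `t` in `headWeight` is the correction by `chi`.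
  partWeight headWeight : ℕ × Bool → Carrier
  partWeight x = if isPlainOdd x then 1# else t
  headWeight x = z ^ ⌈ proj₁ x /2⌉ * (if isPlainOdd x then t else 1#)

  open Weighted partWeight headWeight public

  q^double : ∀ j → q ^ double j ≈ p ^ j
  q^double zero    = refl
  q^double (suc j) = trans (*-congˡ (*-congˡ (q^double j))) (sym (*-assoc q q _))

  w-even : ∀ j b → w (suc (suc (double j)) , b) ≈ t * (p * p ^ j)
  w-even j b rewrite isPlainOdd-even (suc j) b = *-congˡ (q^double (suc j))

  w-plainOdd : ∀ j → w (suc (double j) , false) ≈ q * p ^ j
  w-plainOdd j rewrite isPlainOdd-odd j = trans (*-identityˡ _) (*-congˡ (q^double j))

  w-overlinedOdd : ∀ j → w (suc (double j) , true) ≈ t * (q * p ^ j)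
  w-overlinedOdd j = *-congˡ (*-congˡ (q^double j))

  η-even : ∀ j b → η (suc (suc (double j)) , b) ≈ z * z ^ j * (t * (p * p ^ j))
  η-even j b = *-cong head (w-even j b)
    where
    head : headWeight (suc (suc (double j)) , b) ≈ z * z ^ j
    head rewrite isPlainOdd-even (suc j) b | ⌈double/2⌉ j = *-identityʳ _

  η-overlinedOdd : ∀ j → η (suc (double j) , true) ≈ z * z ^ j * (t * (q * p ^ j))
  η-overlinedOdd j rewrite ⌊double/2⌋ j = *-cong (*-identityʳ _) (w-overlinedOdd j)

  -- Half of 2j + 1 rounds up to j + 1, and `chi` brings the exponent back to j. The other head
  -- parts 2j + 1 and 2j + 2 keep exponent j + 1.
  η-plainOdd : ∀ j → η (suc (double j) , false) ≈ z ^ j * (q * p ^ j)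
  η-plainOdd j = *-cong head (w-plainOdd j)
    where
    head : headWeight (suc (double j) , false) ≈ z ^ j
    head rewrite isPlainOdd-odd j | ⌊double/2⌋ j =
      trans (solve 3 (λ z Z t → z :* Z :* t := z :* t :* Z) refl _ _ _)
        (trans (*-congʳ z*t≈1) (*-identityˡ _))

  -- One step handles the two sizes 2j + 1 and 2j + 2. What may follow a part 2j + 1 is exactly
  -- smaller parts and non-overlined copies of it, so `tails` serves as `A`.
  A B : ℕ → Carrier
  A j = tails (double j)
  B j = partsUpTo (double j)

  A-unfold : ∀ j → A j ≈ B j + q * p ^ j * A j
  A-unfold j = trans (tails-unfold (double j)) (+-congˡ (*-congʳ (w-plainOdd j)))

  odd-parts : ∀ j → partsUpTo (suc (double j)) ≈ (1# + t * (q * p ^ j)) * A j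
  odd-parts j = *-congʳ (+-congˡ (w-overlinedOdd j))

  B-suc : ∀ j → B (suc j) ≈ (1# + t * (p * p ^ j)) * (1# + t * (q * p ^ j)) * (inv (d j 0) * A j)
  B-suc j = begin
    (1# + w (suc (suc (double j)) , true)) * 
      (inv (w (suc (suc (double j)) , false)) * partsUpTo (suc (double j)))
      ≈⟨ *-cong (+-congˡ (w-even j true)) (*-cong (inv-cong (trans (w-even j false)
           (*-congˡ (^-congʳ p (≡.sym (ℕ.+-identityʳ (suc j))))))) (odd-parts j)) ⟩
    (1# + t * (p * p ^ j)) * (inv (d j 0) * ((1# + t * (q * p ^ j)) * A j))
      ≈⟨ solve 4 (λ a i b c → a :* (i :* (b :* c)) := a :* b :* (i :* c)) refl _ _ _ _ ⟩
    (1# + t * (p * p ^ j)) * (1# + t * (q * p ^ j)) * (inv (d j 0) * A j) ∎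

  -- A_j - B_j enumerates those starting with a non-overlined 2j + 1, of head weight z^j; B_(j+1) -
  -- A_j those starting with an overlined 2j + 1 or with 2j + 2, of head weight z^(j+1).
  rankSum-suc : ∀ j → rankSum (double (suc j)) + (z * z ^ j * A j + z ^ j * B j) ≈
                      rankSum (double j) + (z ^ j * A j + z * z ^ j * B (suc j))
  rankSum-suc j = begin
    1# + (R + (η (suc (double j) , false) + η (suc (double j) , true)) * A j
      + (η (suc (suc (double j)) , false) + η (suc (suc (double j)) , true)) * E) + (zZ * A j + Z * B j)
      ≈⟨ +-congʳ (+-congˡ (+-cong (+-congˡ (*-congʳ (+-cong (η-plainOdd j) (η-overlinedOdd j))))
           (*-congʳ (+-cong (η-even j false) (η-even j true))))) ⟩
    1# + (R + (Z * y′ + zZ * o) * A j + (zZ * e′ + zZ * e′) * E) + (zZ * A j + Z * B j)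
      ≈⟨ solve 9 (λ R Z y zZ o A e E B →
           con 1 :+ (R :+ (Z :* y :+ zZ :* o) :* A :+ (zZ :* e :+ zZ :* e) :* E) :+ (zZ :* A :+ Z :* B) :=
           con 1 :+ R :+ (Z :* (B :+ y :* A) :+ zZ :* (((con 1 :+ o) :* A :+ e :* E) :+ e :* E)))
           refl R Z y′ zZ o (A j) e′ E (B j) ⟩
    1# + R + (Z * (B j + y′ * A j) + zZ * (((1# + o) * A j + e′ * E) + e′ * E))
      ≈⟨ +-congˡ (+-cong (*-congˡ (A-unfold j)) (*-congˡ B-suc′)) ⟨
    1# + R + (Z * A j + zZ * B (suc j)) ∎
    where
    R  = ∑ (double j) (λ i → (η (suc i , false) + η (suc i , true)) * tails i)
    E  = tails (suc (double j))
    Z  = z ^ j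
    zZ = z * z ^ j
    y′ = q * p ^ j
    o  = t * (q * p ^ j)
    e′ = t * (p * p ^ j)
    B-suc′ : B (suc j) ≈ ((1# + o) * A j + e′ * E) + e′ * E
    B-suc′ = begin
      (1# + w (suc (suc (double j)) , true)) * E
        ≈⟨ trans (*-congʳ (+-congˡ (w-even j true)))
             (solve 2 (λ v s → (con 1 :+ v) :* s := s :+ v :* s) refl _ _) ⟩
      E + e′ * E
        ≈⟨ +-congʳ (trans (tails-unfold (suc (double j))) (+-cong (odd-parts j) (*-congʳ (w-even j false)))) ⟩
      ((1# + o) * A j + e′ * E) + e′ * E ∎

  T₀≈validSum : T 0 ≈ validSum order
  T₀≈validSum = begin
    T 0
      ≈⟨ T₀≈F A B (λ j → rankSum (double j)) refl (+-identityʳ 1#) A-unfold B-suc rankSum-suc ⟩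
    rankSum (double (suc order))
      ≈⟨ rankSum-stable (ℕ.≤-trans (ℕ.n≤1+n order) (n≤double[n] (suc order))) ⟩
    rankSum order        ≈⟨ validSum≈rankSum order ≡.refl ⟨
    validSum order       ∎

-- Truncated series as operators on arrays of coefficients

-- f m n is the coefficient of z ^ m q ^ n.
Coefficients : Set
Coefficients = ℤ → ℕ → ℕ

infixl 6 _⊕_
infixl 7 _⊗_
-- Series are expressions acting on arrays, with composition as product. Associativity and right
-- distributivity then hold by computation, and exchanging z with 1/z is a recursion on syntax;
-- commutativity needs a proof.
data Operator : Set where
  𝟎 𝟏 𝐳 𝐭 𝐪 : Operator
  _⊕_ _⊗_   : Operator → Operator → Operator

act : Operator → Coefficients → Coefficients
act 𝟎       f m n       = 0
act 𝟏       f m n       = f m n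
act 𝐳       f m n       = f (ℤ.pred m) n
act 𝐭       f m n       = f (ℤ.suc m) n
act 𝐪       f m zero    = 0
act 𝐪       f m (suc n) = f m n
act (a ⊕ b) f m n       = act a f m n ℕ.+ act b f m n
act (a ⊗ b) f           = act a (act b f)

_≗₂_ : Coefficients → Coefficients → Set
f ≗₂ g = ∀ m n → f m n ≡ g m n

-- No generator consults a higher power of q than the one computed; hence products respect equality
-- modulo a power of q.
act-cong< : ∀ a N {f g} → (∀ m n → n ℕ.< N → f m n ≡ g m n) →
            ∀ m n → n ℕ.< N → act a f m n ≡ act a g m n
act-cong< 𝟎 N f≡g m n       n<N = ≡.refl
act-cong< 𝟏 N f≡g m n       n<N = f≡g m n n<N
act-cong< 𝐳 N f≡g m n       n<N = f≡g (ℤ.pred m) n n<N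
act-cong< 𝐭 N f≡g m n       n<N = f≡g (ℤ.suc m) n n<N
act-cong< 𝐪 N f≡g m zero    n<N = ≡.refl
act-cong< 𝐪 N f≡g m (suc n) n<N = f≡g m n (ℕ.<-trans (ℕ.n<1+n n) n<N)
act-cong< (a ⊕ b) N f≡g m n n<N =
  ≡.cong₂ ℕ._+_ (act-cong< a N f≡g m n n<N) (act-cong< b N f≡g m n n<N)
act-cong< (a ⊗ b) N f≡g = act-cong< a N (act-cong< b N f≡g)

act-cong : ∀ a {f g} → f ≗₂ g → act a f ≗₂ act a g
act-cong a f≡g m n = act-cong< a (suc n) (λ m n _ → f≡g m n) m n ℕ.≤-refl

act-+ : ∀ a f g → act a (λ m n → f m n ℕ.+ g m n) ≗₂ (λ m n → act a f m n ℕ.+ act a g m n)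
act-+ 𝟎 f g m n       = ≡.refl
act-+ 𝟏 f g m n       = ≡.refl
act-+ 𝐳 f g m n       = ≡.refl
act-+ 𝐭 f g m n       = ≡.refl
act-+ 𝐪 f g m zero    = ≡.refl
act-+ 𝐪 f g m (suc n) = ≡.refl
act-+ (a ⊕ b) f g m n = ≡.trans (≡.cong₂ ℕ._+_ (act-+ a f g m n) (act-+ b f g m n))
  (ℕ-+.interchange (act a f m n) (act a g m n) (act b f m n) (act b g m n))
act-+ (a ⊗ b) f g m n = ≡.trans (act-cong a (act-+ b f g) m n) (act-+ a _ _ m n)

act-0 : ∀ a → act a (λ _ _ → 0) ≗₂ (λ _ _ → 0)
act-0 𝟎 m n       = ≡.refl
act-0 𝟏 m n       = ≡.refl
act-0 𝐳 m n       = ≡.refl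
act-0 𝐭 m n       = ≡.refl
act-0 𝐪 m zero    = ≡.refl
act-0 𝐪 m (suc n) = ≡.refl
act-0 (a ⊕ b) m n = ≡.cong₂ ℕ._+_ (act-0 a m n) (act-0 b m n)
act-0 (a ⊗ b) m n = ≡.trans (act-cong a (act-0 b) m n) (act-0 a m n)

Commute : Operator → Operator → Set
Commute a b = ∀ f → act a (act b f) ≗₂ act b (act a f)

𝐭-𝐳-commute : Commute 𝐭 𝐳
𝐭-𝐳-commute f m n = ≡.cong (λ k → f k n) (≡.trans (ℤ.pred-suc m) (≡.sym (ℤ.suc-pred m)))

commute-⊗ : ∀ a b c → Commute a c → Commute b c → Commute (a ⊗ b) c
commute-⊗ a b c ac bc f m n =
  ≡.trans (act-cong a (bc f) m n) (ac (act b f) m n)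

commute-𝐪 : ∀ a → Commute a 𝐪
commute-𝐪 𝟎 f m zero    = ≡.refl
commute-𝐪 𝟎 f m (suc n) = ≡.refl
commute-𝐪 𝟏 f m n       = ≡.refl
commute-𝐪 𝐳 f m zero    = ≡.refl
commute-𝐪 𝐳 f m (suc n) = ≡.refl
commute-𝐪 𝐭 f m zero    = ≡.refl
commute-𝐪 𝐭 f m (suc n) = ≡.refl
commute-𝐪 𝐪 f m n       = ≡.refl
commute-𝐪 (a ⊕ b) f m zero    = ≡.cong₂ ℕ._+_ (commute-𝐪 a f m zero) (commute-𝐪 b f m zero)
commute-𝐪 (a ⊕ b) f m (suc n) = ≡.cong₂ ℕ._+_ (commute-𝐪 a f m (suc n)) (commute-𝐪 b f m (suc n))
commute-𝐪 (a ⊗ b) = commute-⊗ a b 𝐪 (commute-𝐪 a) (commute-𝐪 b)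

commute-𝐳 : ∀ a → Commute a 𝐳
commute-𝐳 𝟎 f m n = ≡.refl
commute-𝐳 𝟏 f m n = ≡.refl
commute-𝐳 𝐳 f m n = ≡.refl
commute-𝐳 𝐭       = 𝐭-𝐳-commute
commute-𝐳 𝐪 f m n = ≡.sym (commute-𝐪 𝐳 f m n)
commute-𝐳 (a ⊕ b) f m n = ≡.cong₂ ℕ._+_ (commute-𝐳 a f m n) (commute-𝐳 b f m n)
commute-𝐳 (a ⊗ b) = commute-⊗ a b 𝐳 (commute-𝐳 a) (commute-𝐳 b)

commute-𝐭 : ∀ a → Commute a 𝐭
commute-𝐭 𝟎 f m n = ≡.refl
commute-𝐭 𝟏 f m n = ≡.refl
commute-𝐭 𝐳 f m n = ≡.sym (𝐭-𝐳-commute f m n)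
commute-𝐭 𝐭 f m n = ≡.refl
commute-𝐭 𝐪 f m n = ≡.sym (commute-𝐪 𝐭 f m n)
commute-𝐭 (a ⊕ b) f m n = ≡.cong₂ ℕ._+_ (commute-𝐭 a f m n) (commute-𝐭 b f m n)
commute-𝐭 (a ⊗ b) = commute-⊗ a b 𝐭 (commute-𝐭 a) (commute-𝐭 b)

-- For a generator on the right the induction is on `a`. Sums on the right follow from additivity of
-- `act a`, products by composing.
commute : ∀ a b → Commute a b
commute a 𝟎 f m n = act-0 a m n
commute a 𝟏 f m n = ≡.refl
commute a 𝐳       = commute-𝐳 a
commute a 𝐭       = commute-𝐭 a
commute a 𝐪       = commute-𝐪 a
commute a (b ⊕ c) f m n =
  ≡.trans (act-+ a (act b f) (act c f) m n) (≡.cong₂ ℕ._+_ (commute a b f m n) (commute a c f m n))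
commute a (b ⊗ c) f m n =
  ≡.trans (commute a b (act c f) m n) (act-cong b (commute a c f) m n)

module ModQ (order : ℕ) where

  infix 4 _≈_
  record _≈_ (a b : Operator) : Set where
    constructor equal
    field at : ∀ f m n → n ℕ.≤ order → act a f m n ≡ act b f m n
  open _≈_ public

  commutativeSemiring : CommutativeSemiring 0ℓ 0ℓ
  commutativeSemiring = record
    { Carrier = Operator
    ; _≈_     = _≈_
    ; _+_     = _⊕_
    ; _*_     = _⊗_
    ; 0#      = 𝟎
    ; 1#      = 𝟏
    ; isCommutativeSemiring = Algebra.Structures.Biased.isCommutativeSemiringˡ record
      { +-isCommutativeMonoid = record
        { isMonoid = record
          { isSemigroup = record
            { isMagma = record
              { isEquivalence = ≈-isEquivalence
              ; ∙-cong = λ a≈b c≈d → equal λ f m n n≤ → ≡.cong₂ ℕ._+_ (at a≈b f m n n≤) (at c≈d f m n n≤)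
              }
            ; assoc = λ a b c → equal λ f m n _ → ℕ.+-assoc (act a f m n) _ _
            }
          ; identity = (λ a → equal λ f m n _ → ≡.refl)
                     , (λ a → equal λ f m n _ → ℕ.+-identityʳ _)
          }
        ; comm = λ a b → equal λ f m n _ → ℕ.+-comm (act a f m n) _
        }
      ; *-isCommutativeMonoid = record
        { isMonoid = record
          { isSemigroup = record
            { isMagma = record
              { isEquivalence = ≈-isEquivalence
              ; ∙-cong = λ {a} {b} {c} {d} a≈b c≈d → equal λ f m n n≤ → ≡.trans
                  (act-cong< a (suc order) (λ m n n< → at c≈d f m n (ℕ.≤-pred n<)) m n (s≤s n≤))
                  (at a≈b (act d f) m n n≤)
              }
            ; assoc = λ a b c → equal λ f m n _ → ≡.refl
            }
          ; identity = (λ a → equal λ f m n _ → ≡.refl) , (λ a → equal λ f m n _ → ≡.refl)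
          }
        ; comm = λ a b → equal λ f m n _ → commute a b f m n
        }
      ; distribʳ = λ a b c → equal λ f m n _ → ≡.refl
      ; zeroˡ    = λ a → equal λ f m n _ → ≡.refl
      }
    }
    where
    ≈-isEquivalence : IsEquivalence _≈_
    ≈-isEquivalence = record
      { refl  = equal λ f m n _ → ≡.refl
      ; sym   = λ a≈b → equal λ f m n n≤ → ≡.sym (at a≈b f m n n≤)
      ; trans = λ a≈b b≈c → equal λ f m n n≤ → ≡.trans (at a≈b f m n n≤) (at b≈c f m n n≤)
      }

  open Algebra.Properties.Semiring.Exp (CommutativeSemiring.semiring commutativeSemiring)
    using (_^_)

  𝐪^k-vanishes : ∀ k f m n → n ℕ.< k → act (𝐪 ^ k) f m n ≡ 0
  𝐪^k-vanishes (suc k) f m zero    n<k       = ≡.refl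
  𝐪^k-vanishes (suc k) f m (suc n) (s≤s n<k) = 𝐪^k-vanishes k f m n n<k

  truncation : LaurentTruncation
  truncation = record
    { commutativeSemiring = commutativeSemiring
    ; +-cancelʳ = λ c a+c≈b+c → equal λ f m n n≤ → ℕ.+-cancelʳ-≡ (act c f m n) _ _ (at a+c≈b+c f m n n≤)
    ; z = 𝐳
    ; t = 𝐭
    ; q = 𝐪
    ; z*t≈1 = equal λ f m n _ → ≡.cong (λ k → f k n) (ℤ.suc-pred m)
    ; order = order
    ; q^[1+order]≈0 = equal λ f m n n≤ → 𝐪^k-vanishes (suc order) f m n (s≤s n≤)
    }

-- Positivity and extraction of coefficients

module _ where
  open Data.Integer.Solver.+-*-Solver

  suc[-m]≡-pred[m] : ∀ m → ℤ.suc (ℤ.- m) ≡ ℤ.- ℤ.pred m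
  suc[-m]≡-pred[m] = solve 1 (λ m → con (+ 1) :+ :- m := :- (con (ℤ.- + 1) :+ m)) ≡.refl

  pred[-m]≡-suc[m] : ∀ m → ℤ.pred (ℤ.- m) ≡ ℤ.- ℤ.suc m
  pred[-m]≡-suc[m] = solve 1 (λ m → con (ℤ.- + 1) :+ :- m := :- (con (+ 1) :+ m)) ≡.refl

  pred[m]-i≡m-suc[i] : ∀ m i → ℤ.pred m ℤ.- i ≡ m ℤ.- ℤ.suc i
  pred[m]-i≡m-suc[i] = solve 2 (λ m i → con (ℤ.- + 1) :+ m :- i := m :- (con (+ 1) :+ i)) ≡.refl

  suc[m]+i≡m+suc[i] : ∀ m i → ℤ.suc m ℤ.+ i ≡ m ℤ.+ ℤ.suc i
  suc[m]+i≡m+suc[i] = solve 2 (λ m i → con (+ 1) :+ m :+ i := m :+ (con (+ 1) :+ i)) ≡.refl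

  o-n≡suc[o]-suc[n] : ∀ o n → + 0 ℤ.+ (o ℤ.- n) ≡ ℤ.suc o ℤ.- ℤ.suc n
  o-n≡suc[o]-suc[n] = solve 2 (λ o n → con (+ 0) :+ (o :- n) := (con (+ 1) :+ o) :- (con (+ 1) :+ n)) ≡.refl

  pred[o-n]≡o-suc[n] : ∀ o n → ℤ.pred (o ℤ.- n) ≡ o ℤ.- ℤ.suc n
  pred[o-n]≡o-suc[n] = solve 2 (λ o n → con (ℤ.- + 1) :+ (o :- n) := o :- (con (+ 1) :+ n)) ≡.refl

  m2Rank-rearranged : ∀ h c o n → h ℤ.- c ℤ.+ (o ℤ.- n) ≡ h ℤ.- n ℤ.+ o ℤ.- c
  m2Rank-rearranged = solve 4 (λ h c o n → h :- c :+ (o :- n) := h :- n :+ o :- c) ≡.refl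

double≡n+n : ∀ n → double n ≡ n ℕ.+ n
double≡n+n zero    = ≡.refl
double≡n+n (suc n) = ≡.cong suc (≡.trans (≡.cong suc (double≡n+n n)) (≡.sym (ℕ.+-suc n n)))

swap : Operator → Operator
swap 𝟎       = 𝟎
swap 𝟏       = 𝟏
swap 𝐳       = 𝐭
swap 𝐭       = 𝐳
swap 𝐪       = 𝐪
swap (a ⊕ b) = swap a ⊕ swap b
swap (a ⊗ b) = swap a ⊗ swap b

act-swap : ∀ a f m n → act (swap a) f (ℤ.- m) n ≡ act a (λ k → f (ℤ.- k)) m n
act-swap 𝟎 f m n       = ≡.refl
act-swap 𝟏 f m n       = ≡.refl
act-swap 𝐳 f m n       = ≡.cong (λ k → f k n) (suc[-m]≡-pred[m] m)
act-swap 𝐭 f m n       = ≡.cong (λ k → f k n) (pred[-m]≡-suc[m] m)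
act-swap 𝐪 f m zero    = ≡.refl
act-swap 𝐪 f m (suc n) = ≡.refl
act-swap (a ⊕ b) f m n = ≡.cong₂ ℕ._+_ (act-swap a f m n) (act-swap b f m n)
act-swap (a ⊗ b) f m n =
  ≡.trans (act-swap a (act (swap b) f) m n) (act-cong a (act-swap b f) m n)

-- Unimodality in z and the operators preserving it.

module Positivity (order : ℕ) where
  open ModQ order using (_≈_; at; truncation)
  open Truncated truncation hiding (_≈_; order)

  -- The shape of nonnegative combinations of the χ_j: for each power of q, symmetric about z^0 and
  -- weakly decreasing outwards within each parity class of exponents.
  record Unimodal (f : Coefficients) : Set where
    field
      symmetric  : ∀ m n → n ℕ.≤ order → f (ℤ.- m) n ≡ f m n
      descending : ∀ m n → n ℕ.≤ order → f (+ (2 ℕ.+ m)) n ℕ.≤ f (+ m) n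

    descending* : ∀ c a n → n ℕ.≤ order → f (+ (double c ℕ.+ a)) n ℕ.≤ f (+ a) n
    descending* zero    a n n≤ = ℕ.≤-refl
    descending* (suc c) a n n≤ = ℕ.≤-trans (descending (double c ℕ.+ a) n n≤) (descending* c a n n≤)

    -- The exponents m - i and m + 2 + i have equal parity, and the first is closer to 0. If m < i,
    -- symmetry replaces m - i by i - m.
    spread : ∀ i m n → n ℕ.≤ order → f (+ (2 ℕ.+ m) ℤ.+ + i) n ℕ.≤ f (+ m ℤ.- + i) n
    spread i m n n≤ with ℕ.≤-total i m
    ... | inj₁ i≤m = ≡.subst₂ ℕ._≤_
      (≡.cong (λ k → f (+ k) n) outer) (≡.cong (λ k → f k n) inner)
      (descending* (suc i) (m ℕ.∸ i) n n≤)
      where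
      outer : double (suc i) ℕ.+ (m ℕ.∸ i) ≡ (2 ℕ.+ m) ℕ.+ i
      outer = ≡.cong (2 ℕ.+_) (≡.trans (≡.cong (ℕ._+ (m ℕ.∸ i)) (double≡n+n i))
        (≡.trans (ℕ.+-assoc i i _) (≡.trans (≡.cong (i ℕ.+_) (ℕ.m+[n∸m]≡n i≤m)) (ℕ.+-comm i m))))
      inner : + (m ℕ.∸ i) ≡ + m ℤ.- + i
      inner = ≡.trans (≡.sym (ℤ.⊖-≥ i≤m)) (≡.sym (ℤ.m-n≡m⊖n m i))
    ... | inj₂ m≤i = ≡.subst₂ ℕ._≤_
      (≡.cong (λ k → f (+ k) n) outer)
      (≡.trans (≡.sym (symmetric _ n n≤)) (≡.cong (λ k → f k n) inner))
      (descending* (suc m) (i ℕ.∸ m) n n≤)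
      where
      outer : double (suc m) ℕ.+ (i ℕ.∸ m) ≡ (2 ℕ.+ m) ℕ.+ i
      outer = ≡.cong (2 ℕ.+_) (≡.trans (≡.cong (ℕ._+ (i ℕ.∸ m)) (double≡n+n m))
        (≡.trans (ℕ.+-assoc m m _) (≡.cong (m ℕ.+_) (ℕ.m+[n∸m]≡n m≤i))))
      inner : ℤ.- + (i ℕ.∸ m) ≡ + m ℤ.- + i
      inner = ≡.trans (≡.sym (ℤ.⊖-≤ m≤i)) (≡.sym (ℤ.m-n≡m⊖n m i))

  open Unimodal

  -- Positivity as preservation makes closure under products immediate; the Clebsch-Gordan content
  -- is confined to `positive-inv-pair`.
  record Positive (a : Operator) : Set where
    constructor positive
    field preserves : ∀ {f} → Unimodal f → Unimodal (act a f)
  open Positive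

  positive-≈ : ∀ {a b} → a ≈ b → Positive b → Positive a
  positive-≈ a≈b b⁺ = positive λ {f} f-uni → record
    { symmetric  = λ m n n≤ → ≡.trans (at a≈b f _ n n≤)
        (≡.trans (symmetric (preserves b⁺ f-uni) m n n≤) (≡.sym (at a≈b f _ n n≤)))
    ; descending = λ m n n≤ → ≡.subst₂ ℕ._≤_ (≡.sym (at a≈b f _ n n≤)) (≡.sym (at a≈b f _ n n≤))
        (descending (preserves b⁺ f-uni) m n n≤)
    }

  positive-𝟎 : Positive 𝟎
  positive-𝟎 = positive λ _ → record
    { symmetric  = λ m n n≤ → ≡.refl
    ; descending = λ m n n≤ → z≤n
    }

  positive-𝟏 : Positive 𝟏
  positive-𝟏 = positive λ f-uni → record
    { symmetric = symmetric f-uni ; descending = descending f-uni }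

  positive-𝐪 : Positive 𝐪
  positive-𝐪 = positive λ f-uni → record
    { symmetric  = λ { m zero    n≤ → ≡.refl
                     ; m (suc n) n≤ → symmetric f-uni m n (ℕ.≤-trans (ℕ.n≤1+n n) n≤) }
    ; descending = λ { m zero    n≤ → z≤n
                     ; m (suc n) n≤ → descending f-uni m n (ℕ.≤-trans (ℕ.n≤1+n n) n≤) }
    }

  positive-⊕ : ∀ {a b} → Positive a → Positive b → Positive (a ⊕ b)
  positive-⊕ a⁺ b⁺ = positive λ f-uni → record
    { symmetric  = λ m n n≤ → ≡.cong₂ ℕ._+_ (symmetric (preserves a⁺ f-uni) m n n≤)
                                           (symmetric (preserves b⁺ f-uni) m n n≤)
    ; descending = λ m n n≤ → ℕ.+-mono-≤ (descending (preserves a⁺ f-uni) m n n≤)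
                                        (descending (preserves b⁺ f-uni) m n n≤)
    }

  positive-⊗ : ∀ {a b} → Positive a → Positive b → Positive (a ⊗ b)
  positive-⊗ a⁺ b⁺ = positive λ f-uni → preserves a⁺ (preserves b⁺ f-uni)

  positive-^ : ∀ {a} i → Positive a → Positive (a ^ i)
  positive-^ zero    a⁺ = positive-𝟏
  positive-^ (suc i) a⁺ = positive-⊗ a⁺ (positive-^ i a⁺)

  positive-∑ : ∀ n {f} → (∀ i → Positive (f i)) → Positive (∑ n f)
  positive-∑ zero    f⁺ = positive-𝟎
  positive-∑ (suc n) f⁺ = positive-⊕ (positive-∑ n f⁺) (f⁺ n)

  swap-∑ : ∀ n {f g} → (∀ i → swap (f i) ≡ g i) → swap (∑ n f) ≡ ∑ n g
  swap-∑ zero    eq = ≡.refl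
  swap-∑ (suc n) eq = ≡.cong₂ _⊕_ (swap-∑ n eq) (eq n)

  swap-^ : ∀ {a b} i → swap a ≡ b → swap (a ^ i) ≡ b ^ i
  swap-^ zero    eq = ≡.refl
  swap-^ (suc i) eq = ≡.cong₂ _⊗_ eq (swap-^ i eq)

  swap-inv : ∀ {a b} → swap a ≡ b → swap (inv a) ≡ inv b
  swap-inv eq = swap-∑ (suc order) (λ i → swap-^ i eq)

  act-𝐳^ : ∀ i f m n → act (𝐳 ^ i) f m n ≡ f (m ℤ.- + i) n
  act-𝐳^ zero    f m n = ≡.cong (λ k → f k n) (≡.sym (ℤ.+-identityʳ m))
  act-𝐳^ (suc i) f m n = ≡.trans (act-𝐳^ i f (ℤ.pred m) n) (≡.cong (λ k → f k n)
    (pred[m]-i≡m-suc[i] m (+ i)))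

  act-𝐭^ : ∀ i f m n → act (𝐭 ^ i) f m n ≡ f (m ℤ.+ + i) n
  act-𝐭^ zero    f m n = ≡.cong (λ k → f k n) (≡.sym (ℤ.+-identityʳ m))
  act-𝐭^ (suc i) f m n = ≡.trans (act-𝐭^ i f (ℤ.suc m) n) (≡.cong (λ k → f k n)
    (suc[m]+i≡m+suc[i] m (+ i)))

  act-∑-≤ : ∀ k {a b} f g m m′ n → (∀ i → act (a i) f m n ℕ.≤ act (b i) g m′ n) →
            act (∑ k a) f m n ℕ.≤ act (∑ k b) g m′ n
  act-∑-≤ zero    f g m m′ n a≤b = z≤n
  act-∑-≤ (suc k) f g m m′ n a≤b = ℕ.+-mono-≤ (act-∑-≤ k f g m m′ n a≤b) (a≤b k)

  -- Exchanging z and t swaps the two factors, which gives symmetry. By `inv-pair` the drop from z^m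
  -- to z^(m+2) equals the z^m coefficient of 1 / (1 - zx) minus the z^(m+2) coefficient of 1 / (1 -
  -- tx), applied to f; `spread` compares these power by power in x.
  positive-inv-pair : ∀ {x} → Small x → Positive x → swap x ≡ x →
                      Positive (inv (𝐭 ⊗ x) ⊗ inv (𝐳 ⊗ x))
  positive-inv-pair {x} x-small x⁺ swap-x = positive λ {f} f-uni → record
    { symmetric  = λ m n n≤ → begin
        act (a ⊗ b) f (ℤ.- m) n
          ≡⟨ ≡.cong (λ c → act c f (ℤ.- m) n)
               (≡.cong₂ _⊗_ (swap-inv (≡.cong (𝐭 ⊗_) swap-x)) (swap-inv (≡.cong (𝐳 ⊗_) swap-x))) ⟨
        act (swap (b ⊗ a)) f (ℤ.- m) n
          ≡⟨ act-swap (b ⊗ a) f m n ⟩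
        act (b ⊗ a) (λ k → f (ℤ.- k)) m n
          ≡⟨ act-cong< (b ⊗ a) (suc order) (λ m n n< → symmetric f-uni m n (ℕ.≤-pred n<)) m n (s≤s n≤) ⟩
        act (b ⊗ a) f m n
          ≡⟨ commute b a f m n ⟩
        act (a ⊗ b) f m n ∎
    ; descending = λ m n n≤ → ℕ.+-cancelʳ-≤ (act a f (+ (2 ℕ.+ m)) n) _ _
        (ℕ.≤-trans (ℕ.+-monoʳ-≤ (act (a ⊗ b) f (+ (2 ℕ.+ m)) n) (outer≤inner f-uni m n n≤))
          (ℕ.≤-reflexive (≡.trans (ℕ.+-comm (act (a ⊗ b) f (+ (2 ℕ.+ m)) n) _)
            (≡.sym (at (inv-pair x-small) f (+ m) n n≤)))))
    }
    where
    open ≡.≡-Reasoning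
    a = inv (𝐭 ⊗ x)
    b = inv (𝐳 ⊗ x)
    outer≤inner : ∀ {f} → Unimodal f → ∀ m n → n ℕ.≤ order →
                  act a f (+ (2 ℕ.+ m)) n ℕ.≤ act b f (+ m) n
    outer≤inner {f} f-uni m n n≤ = act-∑-≤ (suc order) f f _ _ n (λ i →
      ≡.subst₂ ℕ._≤_
        (≡.sym (≡.trans (at (^-distrib-* 𝐭 x i) f _ n n≤) (act-𝐭^ i (act (x ^ i) f) _ n)))
        (≡.sym (≡.trans (at (^-distrib-* 𝐳 x i) f _ n n≤) (act-𝐳^ i (act (x ^ i) f) _ n)))
        (spread (preserves (positive-^ i x⁺) f-uni) i m n n≤))

  module _ (P : Parameters) where
    open Parameters P
    open HypergeometricSum P

    -- At j = 0 the kth factors of `D` and `W` are built on the same p^(k+1), so each pair is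
    -- covered by `positive-inv-pair`.
    positive-T₀ : Positive p → swap p ≡ p → (∀ k → Positive (s k)) → Positive (T 0)
    positive-T₀ p⁺ swap-p s⁺ = positive-∑ (suc order) (λ k → positive-⊗ (positive-e k) (positive-DW k))
      where
      positive-e : ∀ k → Positive (e 0 k)
      positive-e zero    = positive-𝟏
      positive-e (suc k) =
        positive-⊗ (positive-e k) (positive-⊗ positive-𝟏 (positive-⊗ positive-𝐪 (s⁺ k)))
      positive-DW : ∀ k → Positive (D 0 k ⊗ W k)
      positive-DW zero    = positive-⊗ positive-𝟏 positive-𝟏
      positive-DW (suc k) = positive-≈
        (solve 4 (λ D a W b → (D :* a) :* (W :* b) := (D :* W) :* (a :* b)) refl _ _ _ _)
        (positive-⊗ (positive-DW k)
          (positive-inv-pair (^-small k p-small) (positive-^ (suc k) p⁺) (swap-^ (suc k) swap-p)))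

-- Monomials and the reading of coefficients.

point : ℤ → ℕ → Coefficients
point j b m n = if ⌊ j ℤ.≟ m ⌋ ∧ (b ≡ᵇ n) then 1 else 0

-- Says that `a` acts as the monomial z^i q^k, tested on the arrays of single monomials.
record Shift (a : Operator) (i : ℤ) (k : ℕ) : Set where
  constructor shift
  field shifts : ∀ j b → act a (point j b) ≗₂ point (i ℤ.+ j) (k ℕ.+ b)
open Shift

⌊≟⌋-cong : ∀ {i j k l : ℤ} → (i ≡ j → k ≡ l) → (k ≡ l → i ≡ j) → ⌊ i ℤ.≟ j ⌋ ≡ ⌊ k ℤ.≟ l ⌋
⌊≟⌋-cong {i} {j} {k} {l} to from = ≡.trans (isYes≗does (i ℤ.≟ j))
  (≡.trans (does-⇔ (mk⇔ to from) (i ℤ.≟ j) (k ℤ.≟ l)) (≡.sym (isYes≗does (k ℤ.≟ l))))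

shift-𝟏 : Shift 𝟏 (+ 0) 0
shift-𝟏 = shift λ j b m n → ≡.cong (λ i → point i b m n) (≡.sym (ℤ.+-identityˡ j))

shift-𝐳 : Shift 𝐳 (+ 1) 0
shift-𝐳 = shift λ j b m n → ≡.cong (λ c → if c ∧ (b ≡ᵇ n) then 1 else 0)
  (⌊≟⌋-cong (λ j≡ → ≡.trans (≡.cong ℤ.suc j≡) (ℤ.suc-pred m))
            (λ ≡m → ≡.trans (≡.sym (ℤ.pred-suc j)) (≡.cong ℤ.pred ≡m)))

shift-𝐭 : Shift 𝐭 (ℤ.- + 1) 0
shift-𝐭 = shift λ j b m n → ≡.cong (λ c → if c ∧ (b ≡ᵇ n) then 1 else 0)
  (⌊≟⌋-cong (λ j≡ → ≡.trans (≡.cong ℤ.pred j≡) (ℤ.pred-suc m))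
            (λ ≡m → ≡.trans (≡.sym (ℤ.suc-pred j)) (≡.cong ℤ.suc ≡m)))

shift-𝐪 : Shift 𝐪 (+ 0) 1
shift-𝐪 = shift λ where
    j b m zero    → ≡.sym (if-∧-false ⌊ (+ 0 ℤ.+ j) ℤ.≟ m ⌋)
    j b m (suc n) → ≡.cong (λ i → point i b m n) (≡.sym (ℤ.+-identityˡ j))
  where
  if-∧-false : ∀ c → (if c ∧ false then 1 else 0) ≡ 0
  if-∧-false true  = ≡.refl
  if-∧-false false = ≡.refl

shift-⊗ : ∀ {a b i j k l} → Shift a i k → Shift b j l → Shift (a ⊗ b) (i ℤ.+ j) (k ℕ.+ l)
shift-⊗ {a} {b} {i} {j} {k} {l} sa sb = shift λ c d m n → ≡.trans (act-cong a (shifts sb c d) m n)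
  (≡.trans (shifts sa _ _ m n)
    (≡.cong₂ (λ x y → point x y m n) (≡.sym (ℤ.+-assoc i j c)) (≡.sym (ℕ.+-assoc k l d))))

shift-cast : ∀ {a i j k l} → i ≡ j → k ≡ l → Shift a i k → Shift a j l
shift-cast ≡.refl ≡.refl sa = sa

module Counting (order : ℕ) where
  open ModQ order using (_≈_; at; truncation)
  open Truncated truncation hiding (_≈_; order)
  open Overpartitions truncation
  open Positivity order

  shift-𝐳^ : ∀ i → Shift (𝐳 ^ i) (+ i) 0
  shift-𝐳^ zero    = shift-𝟏
  shift-𝐳^ (suc i) = shift-⊗ shift-𝐳 (shift-𝐳^ i)

  shift-𝐪^ : ∀ i → Shift (𝐪 ^ i) (+ 0) i
  shift-𝐪^ zero    = shift-𝟏
  shift-𝐪^ (suc i) = shift-⊗ shift-𝐪 (shift-𝐪^ i)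

  unimodal-point : Unimodal (point (+ 0) 0)
  unimodal-point = record
    { symmetric  = λ { (+ zero) n n≤ → ≡.refl ; (+ suc m) n n≤ → ≡.refl ; -[1+ m ] n n≤ → ≡.refl }
    ; descending = λ m n n≤ → z≤n
    }

  module _ (f : Cand → Operator) (rank : Cand → ℤ) (f-shift : ∀ l → Shift (f l) (rank l) (size l)) where

    coefficient : ∀ l m n → act (f l) (point (+ 0) 0) m n ≡ point (rank l) (size l) m n
    coefficient l m n = ≡.trans (shifts (f-shift l) (+ 0) 0 m n)
      (≡.cong₂ (λ i k → point i k m n) (ℤ.+-identityʳ (rank l)) (ℕ.+-identityʳ (size l)))

    -- Applied to the array of the series 1, each valid word yields a single monomial, whose
    -- coefficient at (m, n) is 1 exactly when the word passes both the size and the rank filter.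
    count≡coefficient : ∀ ls m n →
      length (filterᵇ (λ l → ⌊ rank l ℤ.≟ m ⌋) (filterᵇ (λ l → valid l ∧ (size l ≡ᵇ n)) ls)) ≡
      act (sumOver (λ l → [ valid l ] f l) ls) (point (+ 0) 0) m n
    count≡coefficient []       m n = ≡.refl
    count≡coefficient (l ∷ ls) m n with valid l
    ... | false = count≡coefficient ls m n
    ... | true rewrite coefficient l m n with size l ≡ᵇ n
    ...   | false with ⌊ rank l ℤ.≟ m ⌋
    ...     | true  = count≡coefficient ls m n
    ...     | false = count≡coefficient ls m n
    count≡coefficient (l ∷ ls) m n | true | true with ⌊ rank l ℤ.≟ m ⌋
    ...     | true  = ≡.cong suc (count≡coefficient ls m n)
    ...     | false = count≡coefficient ls m n

    -- The array of the series 1 is unimodal, hence so is its image under the positive `a`, and that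
    -- image holds the counts.
    count-descending : ∀ {a} → Positive a → a ≈ sumOver (λ l → [ valid l ] f l) (words (letters order) order) →
      ∀ m → length (filterᵇ (λ l → ⌊ rank l ℤ.≟ + (m ℕ.+ 2) ⌋) (overpartitions order)) ℕ.≤
            length (filterᵇ (λ l → ⌊ rank l ℤ.≟ + m ⌋) (overpartitions order))
    count-descending {a} a⁺ a≈ m rewrite ℕ.+-comm m 2 = ≡.subst₂ ℕ._≤_
      (≡.sym (count≡ (+ (2 ℕ.+ m)))) (≡.sym (count≡ (+ m)))
      (Unimodal.descending (Positive.preserves a⁺ unimodal-point) m order ℕ.≤-refl)
      where
      count≡ : ∀ k → length (filterᵇ (λ l → ⌊ rank l ℤ.≟ k ⌋) (overpartitions order)) ≡
               act a (point (+ 0) 0) k order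
      count≡ k = ≡.trans (count≡coefficient (words (letters order) order) k order)
        (≡.sym (at a≈ _ k order ℕ.≤-refl))

  module D = DRankIdentity truncation
  module M₂ = M2RankIdentity truncation

  D-monomial-shift : ∀ l → Shift (D.monomial l) (ℤ.- + length l) (size l)
  D-monomial-shift []      = shift-𝟏
  D-monomial-shift (x ∷ l) = shift-cast
    (pred[-m]≡-suc[m] (+ length l))
    ≡.refl
    (shift-⊗ (shift-⊗ shift-𝐭 (shift-𝐪^ (proj₁ x))) (D-monomial-shift l))

  D-rankMonomial-shift : ∀ l → Shift (D.rankMonomial l) (dRank l) (size l)
  D-rankMonomial-shift []      = shift-𝟏
  D-rankMonomial-shift (x ∷ l) = shift-⊗ (shift-𝐳^ (proj₁ x)) (D-monomial-shift (x ∷ l))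

  Nbar-descending : ∀ m → Nbar (+ (m ℕ.+ 2)) order ℕ.≤ Nbar (+ m) order
  Nbar-descending = count-descending D.rankMonomial dRank D-rankMonomial-shift
    (positive-T₀ D.parameters p⁺ ≡.refl
      (λ k → positive-⊗ (positive-^ k p⁺) (positive-⊕ positive-𝟏 (positive-^ k p⁺))))
    D.T₀≈validSum
    where p⁺ = positive-⊗ positive-𝐪 positive-𝟏

  M₂-monomial-shift : ∀ l → Shift (M₂.monomial l) (+ numNonOverOdd l ℤ.- + length l) (size l)
  M₂-monomial-shift []            = shift-𝟏
  M₂-monomial-shift ((p , b) ∷ l) with not b ∧ not (p ℕ.% 2 ≡ᵇ 0)
  ... | true  = shift-cast
    (o-n≡suc[o]-suc[n] (+ numNonOverOdd l) (+ length l))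
    ≡.refl (shift-⊗ (shift-⊗ shift-𝟏 (shift-𝐪^ p)) (M₂-monomial-shift l))
  ... | false = shift-cast
    (pred[o-n]≡o-suc[n] (+ numNonOverOdd l) (+ length l))
    ≡.refl (shift-⊗ (shift-⊗ shift-𝐭 (shift-𝐪^ p)) (M₂-monomial-shift l))

  chi-shift : ∀ x l → Shift (if isPlainOdd x then 𝐭 else 𝟏) (ℤ.- + chi (x ∷ l)) 0
  chi-shift (p , b) l with not b ∧ not (p ℕ.% 2 ≡ᵇ 0)
  ... | true  = shift-𝐭
  ... | false = shift-𝟏

  M₂-rankMonomial-shift : ∀ l → Shift (M₂.rankMonomial l) (m2Rank l) (size l)
  M₂-rankMonomial-shift []      = shift-𝟏
  M₂-rankMonomial-shift (x ∷ l) = shift-cast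
    (m2Rank-rearranged (+ ⌈ proj₁ x /2⌉) (+ chi (x ∷ l)) (+ numNonOverOdd (x ∷ l)) (+ length (x ∷ l)))
    ≡.refl
    (shift-⊗ (shift-⊗ (shift-𝐳^ ⌈ proj₁ x /2⌉) (chi-shift x l)) (M₂-monomial-shift (x ∷ l)))

  Nbar2-descending : ∀ m → Nbar2 (+ (m ℕ.+ 2)) order ℕ.≤ Nbar2 (+ m) order
  Nbar2-descending = count-descending M₂.rankMonomial m2Rank M₂-rankMonomial-shift
    (positive-T₀ M₂.parameters p⁺ ≡.refl
      (λ k → positive-⊗ (positive-⊕ positive-𝟏 (positive-^ k p⁺))
        (positive-⊕ positive-𝟏 (positive-⊗ positive-𝐪 (positive-^ k p⁺)))))
    M₂.T₀≈validSum
    where p⁺ = positive-⊗ positive-𝐪 positive-𝐪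

open import Data.Nat using (_+_; _≤_)

theorem1p5 : (m n : ℕ) →
    (Nbar (+ (m + 2)) n ≤ Nbar (+ m) n) × (Nbar2 (+ (m + 2)) n ≤ Nbar2 (+ m) n)
-- The truncation order is `n` itself: the coefficient of q^n is the last one visible modulo
-- q^(n+1), and `overpartitions n` uses words of length and letters up to `n`.
theorem1p5 m n = Counting.Nbar-descending n m , Counting.Nbar2-descending n m
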